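{- Consider a simple graph stream processed by FURL-S and by FURL-SX with buffer size $M$, bucket size $J>0$ and decaying factor $0\le\delta<1$. Let $\lambda$ be any triangle that is counted at time $T_\lambda>M+1$, and let $X_\lambda$ and $Y_\lambda$ be the estimated counts of $\lambda$ by FURL-S and by FURL-SX, respectively. If $T_\lambda\ge\sqrt2\,M+1$, then the interval $\mathbb{E}[Y_\lambda]\pm\operatorname{Var}[Y_\lambda]$ is strictly included in the interval $\mathbb{E}[X_\lambda]\pm\operatorname{Var}[X_\lambda]$, i.e. $$\mathbb{E}[X_\lambda]-\operatorname{Var}[X_\lambda]<\mathbb{E}[Y_\lambda]-\operatorname{Var}[Y_\lambda]\quad\text{and}\quad \mathbb{E}[Y_\lambda]+\operatorname{Var}[Y_\lambda]<\mathbb{E}[X_\lambda]+\operatorname{Var}[X_\lambda].$$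
   Context: A simple graph stream is a fixed sequence of pairwise distinct undirected edges $e_1,e_2,\dots$ without self-loops; the edge $e_T$ arrives at time $T$. A triangle $\lambda$ is formed at the time $T_\lambda$ when the last of its three edges arrives; this is the only time at which it can be counted. Expectations and variances are over the randomness of the algorithm. FURL-S (basic algorithm). It keeps a buffer $D$ of $M$ edges filled by reservoir sampling: the edge arriving at time $T\le M$ is stored; for $T>M$ an integer $i$ is drawn uniformly from $\{1,\dots,T\}$ (independently of the past) and, if $i\le M$, the $i$-th item of $D$ is replaced by the new edge (else the new edge is discarded). Before this sampling step at time $T$, every triangle consisting of the arriving edge and two edges currently in $D$ is counted, with weight $1$ if $T\le M+1$ and weight $q_T=\frac{(T-1)(T-2)}{M(M-1)}$ if $T>M+1$; the weight is added to the estimates of its three nodes. The estimated count $X_\lambda$ of a triangle $\lambda$ by FURL-S is the weight with which $\lambda$ is counted at time $T_\lambda$, or $0$ if it is not counted. FURL-SX. Let $T_M=M+1$ (the last time at which the FURL-S estimate is guaranteed exact). Bucket $0$ is the time interval $[1,T_M]$ and, for $i\ge1$, bucket $i$ is the set of times $t$ with $T_M+(i-1)J<t\le T_M+iJ$. If $c^{(t)}$ is the FURL-S estimate at time $t$, the FURL-SX estimate is $\tau^{(t)}=c^{(t)}$ for $t$ in bucket $0$, and $\tau^{(t)}=\delta\,\tau^{(T_M+(i-1)J)}+(1-\delta)\,c^{(t)}$ for $t$ in bucket $i>0$. Correspondingly, the estimated count of a triangle $\lambda$ by FURL-SX is its contribution to $\tau$: put $x^{(t)}=X_\lambda$ if $t\ge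 T_\lambda$ and $x^{(t)}=0$ if $t<T_\lambda$; let $y^{(t)}=x^{(t)}$ in bucket $0$ and $y^{(t)}=\delta\,y^{(T_M+(i-1)J)}+(1-\delta)\,x^{(t)}$ in bucket $i>0$; then $Y_\lambda=y^{(T)}$ where $T\ge T_\lambda$ is the current time.
   Formalization: The decaying factor is taken with 0 < δ < 1 instead of 0 ≤ δ < 1: for δ = 0 one has Y_λ = X_λ, so the two intervals coincide and the strict inclusion fails; also M ≥ 2, so that q_T is defined. -}

module Defs where

open import Algebra.Bundles using (CommutativeRing)
import Algebra.Properties.Semiring.Mult as SemiringMult
import Algebra.Properties.Semiring.Sum as SemiringSum
open import Data.Bool.Base using (if_then_else_)
open import Data.Fin.Base using (Fin; toℕ; fromℕ<)
open import Data.List.Base using (List; []; _∷_)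
open import Data.List.Relation.Unary.All using (All)
open import Data.List.Relation.Unary.Any using (Any)
open import Data.Maybe.Base using (Maybe; just; nothing)
import Data.Maybe.Relation.Unary.Any as Maybe
open import Data.Nat.Base as ℕ using (ℕ; zero; suc; _∸_; _≤_; s≤s; NonZero)
open import Data.Nat.DivMod using (_/_; m<n*o⇒m/o<n; /-monoˡ-≤; m*n/n≡m)
import Data.Nat.Properties as ℕ
open import Data.Product.Base using (Σ; _×_; _,_; proj₁; proj₂; swap)
open import Data.Product.Properties using (≡-dec)
open import Data.Sum.Base using (_⊎_)
open import Data.Vec.Base using (Vec; replicate; _[_]≔_)
import Data.Vec.Relation.Unary.Any as Vec
open import Level using (Level; _⊔_) renaming (suc to lsuc)
open import Relation.Binary.Core using (Rel)
open import Relation.Binary.Definitions using (DecidableEquality)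
open import Relation.Binary.PropositionalEquality using (_≡_; _≢_; sym; trans; cong)
open import Relation.Binary.Structures using (IsStrictTotalOrder)
open import Relation.Nullary.Decidable using (Dec; yes; no; does; _×-dec_; _⊎-dec_)
open import Relation.Nullary.Negation using (¬_)

private
  variable
    a b v : Level
    A : Set a
    B : Set b

-- ℝ is the intended model. The value of 0# ⁻¹ is left unspecified.

record OrderedField c ℓ₁ ℓ₂ : Set (lsuc (c ⊔ ℓ₁ ⊔ ℓ₂)) where
  infix  4 _<_
  infix  8 _⁻¹
  field
    commutativeRing : CommutativeRing c ℓ₁
  open CommutativeRing commutativeRing public
  field
    _<_                : Rel Carrier ℓ₂
    _⁻¹                : Carrier → Carrier
    isStrictTotalOrder : IsStrictTotalOrder _≈_ _<_
    0<1                : 0# < 1#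
    +-monoʳ-<          : ∀ x {y z} → y < z → x + y < x + z
    *-pos              : ∀ {x y} → 0# < x → 0# < y → 0# < x * y
    ⁻¹-inverseʳ        : ∀ {x} → ¬ (x ≈ 0#) → x * x ⁻¹ ≈ 1#

  infix 4 _≤ᶠ_
  _≤ᶠ_ : Rel Carrier (ℓ₁ ⊔ ℓ₂)
  x ≤ᶠ y = x < y ⊎ x ≈ y

  fromℕ : ℕ → Carrier
  fromℕ n = n ×ᶠ 1#
    where open SemiringMult semiring renaming (_×_ to _×ᶠ_)

  IsSqrt : Carrier → Carrier → Set (ℓ₁ ⊔ ℓ₂)
  IsSqrt r x = (0# ≤ᶠ r) × (r * r ≈ x)

-- Randomised computations as finite decision trees; `uniform n k` draws an
-- element of Fin (suc n) uniformly, independently of all earlier draws.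

data Prob (A : Set a) : Set a where
  return  : A → Prob A
  uniform : (n : ℕ) → (Fin (suc n) → Prob A) → Prob A

infixl 1 _>>=_
_>>=_ : Prob A → (A → Prob B) → Prob B
return x    >>= f = f x
uniform n k >>= f = uniform n (λ i → k i >>= f)

module Expectation {c ℓ₁ ℓ₂} (K : OrderedField c ℓ₁ ℓ₂) where
  open OrderedField K
  open SemiringSum semiring using (sum)

  𝔼 : Prob A → (A → Carrier) → Carrier
  𝔼 (return x)    f = f x
  𝔼 (uniform n k) f = sum (λ i → 𝔼 (k i) f) * fromℕ (suc n) ⁻¹

  Var : Prob A → (A → Carrier) → Carrier
  Var p f = 𝔼 p (λ x → (f x - 𝔼 p f) * (f x - 𝔼 p f))

Edge : Set v → Set v
Edge V = V × V

-- Equality of undirected edges.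

infix 4 _~_
_~_ : {V : Set v} → Edge V → Edge V → Set v
e ~ f = (e ≡ f) ⊎ (e ≡ swap f)

-- `edge k` arrives at time suc (toℕ k), so that times run through 1, …, N.

record SimpleStream (V : Set v) (N : ℕ) : Set v where
  field
    edge     : Fin N → Edge V
    loopless : ∀ k → proj₁ (edge k) ≢ proj₂ (edge k)
    distinct : ∀ j k → edge j ~ edge k → j ≡ k

record Triangle (V : Set v) : Set v where
  field
    x y z : V
    x≢y   : x ≢ y
    y≢z   : y ≢ z
    x≢z   : x ≢ z

  xy yz xz : Edge V
  xy = x , y
  yz = y , z
  xz = x , z

  edges : List (Edge V)
  edges = xy ∷ yz ∷ xz ∷ []

-- All edges of the triangle have arrived by time t, one of them at time t.

FormedAt : {V : Set v} {N : ℕ} → SimpleStream V N → Triangle V → ℕ → Set v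
FormedAt {N = N} S Δ t =
    All (λ f → Σ (Fin N) λ k → (suc (toℕ k) ≤ t) × (f ~ edge k)) (Triangle.edges Δ)
  × Any (λ f → Σ (Fin N) λ k → (suc (toℕ k) ≡ t) × (f ~ edge k)) (Triangle.edges Δ)
  where open SimpleStream S

module FURL-S {c ℓ₁ ℓ₂} (K : OrderedField c ℓ₁ ℓ₂)
              {V : Set v} (_≟_ : DecidableEquality V) (M : ℕ) where
  open OrderedField K hiding (zero)

  -- Slots that have not been filled yet hold `nothing`.
  Buffer : Set v
  Buffer = Vec (Maybe (Edge V)) M

  infix 4 _∈_ _~?_ _∈?_
  _∈_ : Edge V → Buffer → Set v
  f ∈ D = Vec.Any (Maybe.Any (f ~_)) D

  _~?_ : (e f : Edge V) → Dec (e ~ f)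
  e ~? f = ≡-dec _≟_ _≟_ e f ⊎-dec ≡-dec _≟_ _≟_ e (swap f)

  _∈?_ : (f : Edge V) (D : Buffer) → Dec (f ∈ D)
  f ∈? D = Vec.any? (Maybe.dec (f ~?_)) D

  -- Δ consists of the edge e and two edges of D.
  ConsistsOf : Triangle V → Edge V → Buffer → Set v
  ConsistsOf Δ e D = (xy ~ e × yz ∈ D × xz ∈ D)
                   ⊎ (yz ~ e × xy ∈ D × xz ∈ D)
                   ⊎ (xz ~ e × xy ∈ D × yz ∈ D)
    where open Triangle Δ

  consistsOf? : ∀ Δ e D → Dec (ConsistsOf Δ e D)
  consistsOf? Δ e D = ((xy ~? e) ×-dec (yz ∈? D) ×-dec (xz ∈? D))
                ⊎-dec ((yz ~? e) ×-dec (xy ∈? D) ×-dec (xz ∈? D))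
                ⊎-dec ((xz ~? e) ×-dec (xy ∈? D) ×-dec (yz ∈? D))
    where open Triangle Δ

  q : ℕ → Carrier
  q T = fromℕ ((T ∸ 1) ℕ.* (T ∸ 2)) * fromℕ (M ℕ.* (M ∸ 1)) ⁻¹

  weight : ℕ → Carrier
  weight T = if does (T ℕ.≤? M ℕ.+ 1) then 1# else q T

  -- Reservoir sampling at time suc k; slots and draws are numbered from 0.
  sample : ℕ → Edge V → Buffer → Prob Buffer
  sample k e D with k ℕ.<? M
  ... | yes k<M = return (D [ fromℕ< k<M ]≔ just e)
  ... | no  _   = uniform k λ i → return (replace (toℕ i))
    where
    replace : ℕ → Buffer
    replace i with i ℕ.<? M
    ... | yes i<M = D [ fromℕ< i<M ]≔ just e
    ... | no  _   = D

  record State : Set (c ⊔ v) where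
    constructor ⟨_,_⟩
    field
      buffer : Buffer
      count  : Triangle V → Carrier   -- weight with which counted, 0# if not
  open State public

  initial : State
  initial = ⟨ replicate M nothing , (λ _ → 0#) ⟩

  updateCount : ℕ → Edge V → State → Triangle V → Carrier
  updateCount T e s Δ =
    if does (consistsOf? Δ e (buffer s)) then weight T else count s Δ

  step : ℕ → Edge V → State → Prob State
  step k e s = sample k e (buffer s) >>= λ D →
               return ⟨ D , updateCount (suc k) e s ⟩

  -- The state of the algorithm after the first t edges.
  run : ∀ {N} → SimpleStream V N → ∀ t → t ≤ N → Prob State
  run S zero    _   = return initial
  run S (suc k) k<N = run S k (ℕ.<⇒≤ k<N) >>= step k (edge (fromℕ< k<N))
    where open SimpleStream S

module Buckets (M J : ℕ) .{{_ : NonZero J}} where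

  T-M : ℕ
  T-M = M ℕ.+ 1

  -- ⌈ (t - T-M) / J ⌉
  bucket : ℕ → ℕ
  bucket t = ((t ∸ T-M) ℕ.+ (J ∸ 1)) / J

  private
    /-unique : ∀ {m} i → i ℕ.* J ≤ m → m ℕ.< suc i ℕ.* J → m / J ≡ i
    /-unique {m} i lo hi = ℕ.≤-antisym (ℕ.<⇒≤pred (m<n*o⇒m/o<n hi))
      (ℕ.≤-trans (ℕ.≤-reflexive (sym (m*n/n≡m i J))) (/-monoˡ-≤ J lo))

    J≡ : suc (J ∸ 1) ≡ J
    J≡ = ℕ.suc-pred J

  bucket-zero : ∀ {t} → t ≤ T-M → bucket t ≡ 0
  bucket-zero {t} t≤ rewrite ℕ.m≤n⇒m∸n≡0 t≤ =
    /-unique 0 ℕ.z≤n (ℕ.≤-reflexive (trans J≡ (sym (ℕ.+-identityʳ J))))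

  bucket-suc : ∀ {t} i → T-M ℕ.+ i ℕ.* J ℕ.< t → t ≤ T-M ℕ.+ suc i ℕ.* J →
               bucket t ≡ suc i
  bucket-suc {t} i lo hi = /-unique (suc i) lower upper
    where
    open ℕ.≤-Reasoning
    lo′ : suc (i ℕ.* J) ≤ t ∸ T-M
    lo′ = begin
      suc (i ℕ.* J)                     ≡⟨ ℕ.m+n∸m≡n T-M _ ⟨
      (T-M ℕ.+ suc (i ℕ.* J)) ∸ T-M     ≡⟨ cong (_∸ T-M) (ℕ.+-suc T-M _) ⟩
      suc (T-M ℕ.+ i ℕ.* J) ∸ T-M       ≤⟨ ℕ.∸-monoˡ-≤ T-M lo ⟩
      t ∸ T-M                           ∎
    lower : suc i ℕ.* J ≤ (t ∸ T-M) ℕ.+ (J ∸ 1)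
    lower = begin
      J ℕ.+ i ℕ.* J                     ≡⟨ cong (ℕ._+ i ℕ.* J) J≡ ⟨
      suc (J ∸ 1) ℕ.+ i ℕ.* J           ≡⟨ ℕ.+-suc (J ∸ 1) _ ⟨
      (J ∸ 1) ℕ.+ suc (i ℕ.* J)         ≡⟨ ℕ.+-comm (J ∸ 1) _ ⟩
      suc (i ℕ.* J) ℕ.+ (J ∸ 1)         ≤⟨ ℕ.+-monoˡ-≤ (J ∸ 1) lo′ ⟩
      (t ∸ T-M) ℕ.+ (J ∸ 1)             ∎
    upper : (t ∸ T-M) ℕ.+ (J ∸ 1) ℕ.< suc (suc i) ℕ.* J
    upper = begin-strict
      (t ∸ T-M) ℕ.+ (J ∸ 1)             ≤⟨ ℕ.+-monoˡ-≤ (J ∸ 1) (ℕ.m≤n+o⇒m∸n≤o _ T-M hi) ⟩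
      suc i ℕ.* J ℕ.+ (J ∸ 1)           <⟨ ℕ.+-monoʳ-< (suc i ℕ.* J) (ℕ.≤-reflexive J≡) ⟩
      suc i ℕ.* J ℕ.+ J                 ≡⟨ ℕ.+-comm (suc i ℕ.* J) J ⟩
      suc (suc i) ℕ.* J                 ∎

module FURL-SX {c ℓ₁ ℓ₂} (K : OrderedField c ℓ₁ ℓ₂)
               (M J : ℕ) .{{_ : NonZero J}} (δ : OrderedField.Carrier K) where
  open OrderedField K hiding (zero)
  open Buckets M J public

  -- `decayIn x i t` is the value at a time t of bucket i; the time T-M + i J is
  -- the last one of bucket i.
  decayIn : (ℕ → Carrier) → ℕ → ℕ → Carrier
  decayIn x zero    t = x t
  decayIn x (suc i) t = δ * decayIn x i (T-M ℕ.+ i ℕ.* J) + (1# - δ) * x t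

  decay : (ℕ → Carrier) → ℕ → Carrier
  decay x t = decayIn x (bucket t) t

  -- Contribution at time T of a triangle formed at time Tλ whose FURL-S
  -- estimate is X.
  contribution : (Tλ : ℕ) (X : Carrier) (T : ℕ) → Carrier
  contribution Tλ X = decay (λ t → if does (Tλ ℕ.≤? t) then X else 0#)

{-# OPTIONS --safe #-}

-- Put n = Tλ − 1.  Reservoir sampling keeps a fixed pair of the first n edges
-- with probability M(M−1)/n(n−1) = 1/q, so X = q·1[both kept] has mean 1 and
-- variance v = q − 1.  Unfolding the exponential decay gives Y = κX with a
-- constant 0 < κ < 1, hence mean κ and variance κ²v.  With μ = 1 − κ the two
-- inequalities amount to μ < μ(1 + κ)v and κ + κ²v < 1 + v, which hold as soon
-- as v ≥ 1, that is n(n−1) ≥ 2M(M−1); this follows from n ≥ √2 M.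
module Submission where

import Algebra.Properties.Ring as RingProperties
import Algebra.Properties.Semiring.Mult as SemiringMult
import Algebra.Properties.Semiring.Sum as SemiringSum
import Algebra.Solver.Ring.NaturalCoefficients.Default as SemiringSolver
open import Data.Bool.Base using (if_then_else_)
open import Data.Empty using (⊥-elim)
open import Data.Fin.Base using (Fin; fromℕ<; toℕ)
  renaming (suc to fsuc; zero to fzero)
open import Data.Fin.Properties using (toℕ-fromℕ<; toℕ-injective; toℕ<n)
open import Data.List.Relation.Unary.All as All using (All; []; _∷_)
open import Data.List.Relation.Unary.Any using (Any; here; there)
open import Data.Maybe.Base using (Maybe; just; nothing)
import Data.Maybe.Relation.Unary.Any as Maybe
open import Data.Nat.Base as ℕ using (NonZero; _∸_; suc; s≤s; zero; z≤n; ℕ)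
open import Data.Nat.DivMod using (m/n≡0⇒m<n)
import Data.Nat.Properties as ℕ
open import Data.Product.Base using (_,_; _×_; proj₁; proj₂; swap; Σ; ∃)
open import Data.Sum.Base using (_⊎_; inj₁; inj₂)
open import Data.Unit.Base using (tt)
open import Data.Vec.Base using (Vec; _[_]≔_; _∷_; lookup; replicate)
open import Data.Vec.Properties using (lookup-replicate; lookup∘update; lookup∘update′)
import Data.Vec.Relation.Unary.Any as Vec
import Data.Vec.Relation.Unary.Any.Properties as Vec
open import Defs
open import Function.Base using (_$_; _∘_)
open import Function.Bundles using (Equivalence; _⇔_; mk⇔)
open import Level using (_⊔_)
open import Relation.Binary.Bundles using (StrictPartialOrder)
open import Relation.Binary.Definitions using (DecidableEquality; tri<; tri>; tri≈)
open import Relation.Binary.PropositionalEquality as ≡ using (_≡_; _≢_)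
import Relation.Binary.Reasoning.StrictPartialOrder as StrictReasoning
open import Relation.Binary.Structures using (IsStrictTotalOrder)
open import Relation.Nullary.Decidable using (Dec; _×-dec_; dec-false; does; does-⇔; no; yes; ¬?)
open import Relation.Nullary.Negation using (contradiction; ¬_)

-- The inclusion probabilities come from a recursion on time that starts at the full buffer. Given a
-- buffer D, the chance that certain edges are held after one more arrival is a constant times an
-- indicator of D, so averaging over D only multiplies the earlier probability by that constant.
-- This requires a pathwise invariant: no edge is held in two slots, and none is held before its
-- arrival. The pair recursion does not close on itself: if one edge of the pair is the newest, it
-- falls back on the probability of a single edge, so there are two inductions. They are stated with
-- denominators multiplied out. Two assumptions carry weight. For δ = 0 the decay returns X
-- unchanged, so κ = 1 and strict inclusion fails; hence 0 < δ. For M ≤ 1 the weight q would divide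
-- by M(M-1) = 0; hence 2 ≤ M.

module OrderedFieldProperties {c ℓ₁ ℓ₂} (K : OrderedField c ℓ₁ ℓ₂) where
  open OrderedField K hiding (zero)
  open IsStrictTotalOrder isStrictTotalOrder public
    using (compare; isStrictPartialOrder)
    renaming (irrefl to <-irrefl; trans to <-trans; asym to <-asym)
  open SemiringMult semiring using (×1-homo-*)
  module R = RingProperties ring
  module Solver = SemiringSolver commutativeSemiring
  open Solver using (solve; _:=_; _:+_; _:*_)

  strictPartialOrder : StrictPartialOrder c ℓ₁ ℓ₂
  strictPartialOrder = record { isStrictPartialOrder = isStrictPartialOrder }

  module <-Reasoning = StrictReasoning strictPartialOrder
  open <-Reasoning

  -- Arithmetic and order in an ordered field

  -‿+-cancel : ∀ x y → x - y + y ≈ x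
  -‿+-cancel x y = begin-equality
    x - y + y     ≈⟨ +-assoc x (- y) y ⟩
    x + (- y + y) ≈⟨ +-congˡ (-‿inverseˡ y) ⟩
    x + 0#        ≈⟨ +-identityʳ x ⟩
    x             ∎

  +‿--cancel : ∀ x y → x + y - y ≈ x
  +‿--cancel x y = begin-equality
    x + y - y     ≈⟨ +-assoc x y (- y) ⟩
    x + (y - y)   ≈⟨ +-congˡ (-‿inverseʳ y) ⟩
    x + 0#        ≈⟨ +-identityʳ x ⟩
    x             ∎

  +-monoˡ-< : ∀ x {y z} → y < z → y + x < z + x
  +-monoˡ-< x {y} {z} y<z = begin-strict
    y + x ≈⟨ +-comm y x ⟩
    x + y <⟨ +-monoʳ-< x y<z ⟩
    x + z ≈⟨ +-comm x z ⟩
    z + x ∎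

  +-monoˡ-≤ : ∀ x {y z} → y ≤ᶠ z → y + x ≤ᶠ z + x
  +-monoˡ-≤ x (inj₁ y<z) = inj₁ (+-monoˡ-< x y<z)
  +-monoˡ-≤ x (inj₂ y≈z) = inj₂ (+-congʳ y≈z)

  +-monoʳ-≤ : ∀ x {y z} → y ≤ᶠ z → x + y ≤ᶠ x + z
  +-monoʳ-≤ x (inj₁ y<z) = inj₁ (+-monoʳ-< x y<z)
  +-monoʳ-≤ x (inj₂ y≈z) = inj₂ (+-congˡ y≈z)

  +-cancelʳ-≤ : ∀ x {y z} → y + x ≤ᶠ z + x → y ≤ᶠ z
  +-cancelʳ-≤ x {y} {z} le = begin
    y         ≈⟨ +‿--cancel y x ⟨
    y + x - x ≤⟨ +-monoˡ-≤ (- x) le ⟩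
    z + x - x ≈⟨ +‿--cancel z x ⟩
    z         ∎

  +-cancelʳ : ∀ x {y z} → y + x ≈ z + x → y ≈ z
  +-cancelʳ x {y} {z} eq = begin-equality
    y         ≈⟨ +‿--cancel y x ⟨
    y + x - x ≈⟨ +-congʳ eq ⟩
    z + x - x ≈⟨ +‿--cancel z x ⟩
    z         ∎

  x<y⇒0<y-x : ∀ {x y} → x < y → 0# < y - x
  x<y⇒0<y-x {x} {y} x<y = begin-strict
    0#    ≈⟨ -‿inverseʳ x ⟨
    x - x <⟨ +-monoˡ-< (- x) x<y ⟩
    y - x ∎

  a+d<c+b⇒a-b<c-d : ∀ {a b c d} → a + d < c + b → a - b < c - d
  a+d<c+b⇒a-b<c-d {a} {b} {c} {d} lt = begin-strict
    a - b             ≈⟨ +‿--cancel (a - b) d ⟨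
    a - b + d - d     ≈⟨ +-congʳ (solve 3 (λ a b d → a :+ b :+ d := a :+ d :+ b) refl a (- b) d) ⟩
    a + d - b - d     <⟨ +-monoˡ-< (- d) (+-monoˡ-< (- b) lt) ⟩
    c + b - b - d     ≈⟨ +-congʳ (+‿--cancel c b) ⟩
    c - d             ∎

  *-monoʳ-< : ∀ {x y z} → 0# < x → y < z → x * y < x * z
  *-monoʳ-< {x} {y} {z} 0<x y<z = begin-strict
    x * y                 ≈⟨ +-identityˡ (x * y) ⟨
    0# + x * y            <⟨ +-monoˡ-< (x * y) (*-pos 0<x (x<y⇒0<y-x y<z)) ⟩
    x * (z - y) + x * y   ≈⟨ distribˡ x (z - y) y ⟨
    x * (z - y + y)       ≈⟨ *-congˡ (-‿+-cancel z y) ⟩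
    x * z                 ∎

  *-monoʳ-≤ : ∀ {x y z} → 0# ≤ᶠ x → y ≤ᶠ z → x * y ≤ᶠ x * z
  *-monoʳ-≤ (inj₁ 0<x) (inj₁ y<z) = inj₁ (*-monoʳ-< 0<x y<z)
  *-monoʳ-≤ {x} {y} {z} (inj₂ 0≈x) (inj₁ y<z) = inj₂ $ begin-equality
    x * y  ≈⟨ *-congʳ 0≈x ⟨
    0# * y ≈⟨ zeroˡ y ⟩
    0#     ≈⟨ zeroˡ z ⟨
    0# * z ≈⟨ *-congʳ 0≈x ⟩
    x * z  ∎
  *-monoʳ-≤ _ (inj₂ y≈z) = inj₂ (*-congˡ y≈z)

  ≤⇒≯ : ∀ {x y} → x ≤ᶠ y → ¬ (y < x)
  ≤⇒≯ (inj₁ x<y) y<x = <-asym x<y y<x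
  ≤⇒≯ (inj₂ x≈y) y<x = <-irrefl (sym x≈y) y<x

  0<x⇒x≉0 : ∀ {x} → 0# < x → ¬ (x ≈ 0#)
  0<x⇒x≉0 0<x x≈0 = <-irrefl (sym x≈0) 0<x

  -- By trichotomy: if the inverse were zero or negative, then 1 = x x⁻¹ would be at most 0.
  0<x⇒0<x⁻¹ : ∀ {x} → 0# < x → 0# < x ⁻¹
  0<x⇒0<x⁻¹ {x} 0<x with compare 0# (x ⁻¹)
  ... | tri< 0<x⁻¹ _ _ = 0<x⁻¹
  ... | tri≈ _ 0≈x⁻¹ _ = ⊥-elim $ <-irrefl refl $ begin-strict
    0#       <⟨ 0<1 ⟩
    1#       ≈⟨ ⁻¹-inverseʳ (0<x⇒x≉0 0<x) ⟨
    x * x ⁻¹ ≈⟨ *-congˡ 0≈x⁻¹ ⟨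
    x * 0#   ≈⟨ zeroʳ x ⟩
    0#       ∎
  ... | tri> _ _ x⁻¹<0 = ⊥-elim $ <-irrefl refl $ begin-strict
    0#       <⟨ 0<1 ⟩
    1#       ≈⟨ ⁻¹-inverseʳ (0<x⇒x≉0 0<x) ⟨
    x * x ⁻¹ <⟨ *-monoʳ-< 0<x x⁻¹<0 ⟩
    x * 0#   ≈⟨ zeroʳ x ⟩
    0#       ∎

  fromℕ-homo-* : ∀ m n → fromℕ (m ℕ.* n) ≈ fromℕ m * fromℕ n
  fromℕ-homo-* = ×1-homo-*

  0≤fromℕ : ∀ n → 0# ≤ᶠ fromℕ n
  0≤fromℕ zero    = inj₂ refl
  0≤fromℕ (suc n) = begin
    0#           ≤⟨ 0≤fromℕ n ⟩
    fromℕ n      ≈⟨ +-identityˡ (fromℕ n) ⟨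
    0# + fromℕ n <⟨ +-monoˡ-< (fromℕ n) 0<1 ⟩
    1# + fromℕ n ∎

  0<fromℕ : ∀ {n} → 0 ℕ.< n → 0# < fromℕ n
  0<fromℕ {suc n} _ = begin-strict
    0#           <⟨ 0<1 ⟩
    1#           ≈⟨ +-identityʳ 1# ⟨
    1# + 0#      ≤⟨ +-monoʳ-≤ 1# (0≤fromℕ n) ⟩
    1# + fromℕ n ∎

  fromℕ-inverseʳ : ∀ n → fromℕ (suc n) * fromℕ (suc n) ⁻¹ ≈ 1#
  fromℕ-inverseʳ n = ⁻¹-inverseʳ (0<x⇒x≉0 (0<fromℕ (ℕ.z<s {n})))

  fromℕ-mono-≤ : ∀ {m n} → m ℕ.≤ n → fromℕ m ≤ᶠ fromℕ n
  fromℕ-mono-≤ {n = n} z≤n   = 0≤fromℕ n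
  fromℕ-mono-≤ (s≤s m≤n) = +-monoʳ-≤ 1# (fromℕ-mono-≤ m≤n)

  fromℕ-mono-< : ∀ {m n} → m ℕ.< n → fromℕ m < fromℕ n
  fromℕ-mono-< {m} {n} m<n = begin-strict
    fromℕ m      ≈⟨ +-identityˡ (fromℕ m) ⟨
    0# + fromℕ m <⟨ +-monoˡ-< (fromℕ m) 0<1 ⟩
    1# + fromℕ m ≤⟨ fromℕ-mono-≤ m<n ⟩
    fromℕ n      ∎

  fromℕ-cancel-≤ : ∀ {m n} → fromℕ m ≤ᶠ fromℕ n → m ℕ.≤ n
  fromℕ-cancel-≤ le = ℕ.≮⇒≥ (≤⇒≯ le ∘ fromℕ-mono-<)

  -- The square root is eliminated here. Squaring is done one factor at a time, by monotonicity with
  -- r m ≥ 0 and then n ≥ 0; since `fromℕ` reflects the order, the outcome is an inequality of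
  -- natural numbers.
  √2m≤n⇒2m²≤n² : ∀ {r} m n → IsSqrt r (fromℕ 2) → r * fromℕ m ≤ᶠ fromℕ n →
                 2 ℕ.* (m ℕ.* m) ℕ.≤ n ℕ.* n
  √2m≤n⇒2m²≤n² {r} m n (0≤r , r²≈2) rm≤n = fromℕ-cancel-≤ $ begin
    fromℕ (2 ℕ.* (m ℕ.* m))           ≈⟨ fromℕ-homo-* 2 (m ℕ.* m) ⟩
    fromℕ 2 * fromℕ (m ℕ.* m)         ≈⟨ *-cong r²≈2 (sym (fromℕ-homo-* m m)) ⟨
    r * r * (fromℕ m * fromℕ m)       ≈⟨ solve 2 (λ r m → r :* r :* (m :* m) := r :* m :* (r :* m)) refl r (fromℕ m) ⟩
    r * fromℕ m * (r * fromℕ m)       ≤⟨ *-monoʳ-≤ 0≤rm rm≤n ⟩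
    r * fromℕ m * fromℕ n             ≈⟨ *-comm (r * fromℕ m) (fromℕ n) ⟩
    fromℕ n * (r * fromℕ m)           ≤⟨ *-monoʳ-≤ (0≤fromℕ n) rm≤n ⟩
    fromℕ n * fromℕ n                 ≈⟨ fromℕ-homo-* n n ⟨
    fromℕ (n ℕ.* n)                   ∎
    where
    0≤rm : 0# ≤ᶠ r * fromℕ m
    0≤rm = begin
      0#          ≈⟨ zeroʳ r ⟨
      r * 0#      ≤⟨ *-monoʳ-≤ 0≤r (0≤fromℕ m) ⟩
      r * fromℕ m ∎

  2b≤a⇒2≤a/b : ∀ {a b} → 0 ℕ.< b → 2 ℕ.* b ℕ.≤ a → fromℕ 2 ≤ᶠ fromℕ a * fromℕ b ⁻¹
  2b≤a⇒2≤a/b {a} {b} 0<b 2b≤a = begin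
    fromℕ 2                          ≈⟨ *-identityʳ (fromℕ 2) ⟨
    fromℕ 2 * 1#                     ≈⟨ *-congˡ (⁻¹-inverseʳ (0<x⇒x≉0 (0<fromℕ 0<b))) ⟨
    fromℕ 2 * (fromℕ b * fromℕ b ⁻¹) ≈⟨ solve 3 (λ x y z → x :* (y :* z) := z :* (x :* y)) refl (fromℕ 2) (fromℕ b) (fromℕ b ⁻¹) ⟩
    fromℕ b ⁻¹ * (fromℕ 2 * fromℕ b) ≈⟨ *-congˡ (fromℕ-homo-* 2 b) ⟨
    fromℕ b ⁻¹ * fromℕ (2 ℕ.* b)     ≤⟨ *-monoʳ-≤ (inj₁ (0<x⇒0<x⁻¹ (0<fromℕ 0<b))) (fromℕ-mono-≤ 2b≤a) ⟩
    fromℕ b ⁻¹ * fromℕ a             ≈⟨ *-comm (fromℕ b ⁻¹) (fromℕ a) ⟩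
    fromℕ a * fromℕ b ⁻¹             ∎

  -- Divided by 1 - κ, the lower inequality reads 1 < (1 + κ)v, and 1 ≤ v is exactly the condition
  -- under which this holds for every κ in (0,1). The solver knows only semirings: subtractions are
  -- moved across first, and μ is treated as a variable of its own subject to κ + μ = 1.
  scaled-interval-⊂ : ∀ {κ v} → 0# < κ → κ < 1# → 1# ≤ᶠ v →
                      (1# - v < κ - κ * κ * v) × (κ + κ * κ * v < 1# + v)
  scaled-interval-⊂ {κ} {v} 0<κ κ<1 1≤v = a+d<c+b⇒a-b<c-d lower , upper
    where
    μ = 1# - κ

    0<μ : 0# < μ
    0<μ = x<y⇒0<y-x κ<1

    κ+μ≈1 : κ + μ ≈ 1#
    κ+μ≈1 = trans (+-comm κ μ) (-‿+-cancel 1# κ)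

    0<v : 0# < v
    0<v = begin-strict
      0# <⟨ 0<1 ⟩
      1# ≤⟨ 1≤v ⟩
      v  ∎

    -- The factor 1 + κ is written as (κ + μ) + κ, so that the identity used in `lower` becomes
    -- polynomial in κ, μ and v.
    1<[κ+μ]v+κv : 1# < (κ + μ) * v + κ * v
    1<[κ+μ]v+κv = begin-strict
      1#                    ≤⟨ 1≤v ⟩
      v                     ≈⟨ +-identityʳ v ⟨
      v + 0#                <⟨ +-monoʳ-< v (*-pos 0<κ 0<v) ⟩
      v + κ * v             ≈⟨ +-congʳ (*-identityˡ v) ⟨
      1# * v + κ * v        ≈⟨ +-congʳ (*-congʳ κ+μ≈1) ⟨
      (κ + μ) * v + κ * v   ∎

    lower : 1# + κ * κ * v < κ + v
    lower = begin-strict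
      1# + κ * κ * v
        ≈⟨ +-congʳ κ+μ≈1 ⟨
      κ + μ + κ * κ * v
        ≈⟨ solve 3 (λ κ μ d → κ :+ μ :+ d := κ :+ d :+ μ) refl κ μ (κ * κ * v) ⟩
      κ + κ * κ * v + μ
        ≈⟨ +-congˡ (*-identityʳ μ) ⟨
      κ + κ * κ * v + μ * 1#
        <⟨ +-monoʳ-< _ (*-monoʳ-< 0<μ 1<[κ+μ]v+κv) ⟩
      κ + κ * κ * v + μ * ((κ + μ) * v + κ * v)
        -- This is κ² + μ((κ + μ) + κ) = (κ + μ)², multiplied by v.
        ≈⟨ solve 3 (λ κ μ v → κ :+ κ :* κ :* v :+ μ :* ((κ :+ μ) :* v :+ κ :* v)
                           := κ :+ (κ :+ μ) :* (κ :+ μ) :* v) refl κ μ v ⟩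
      κ + (κ + μ) * (κ + μ) * v
        ≈⟨ +-congˡ (*-congʳ (*-cong κ+μ≈1 κ+μ≈1)) ⟩
      κ + 1# * 1# * v
        ≈⟨ +-congˡ (trans (*-congʳ (*-identityˡ 1#)) (*-identityˡ v)) ⟩
      κ + v ∎

    upper : κ + κ * κ * v < 1# + v
    upper = begin-strict
      κ + κ * κ * v    <⟨ +-monoˡ-< _ κ<1 ⟩
      1# + κ * κ * v   ≈⟨ +-congˡ (solve 2 (λ κ v → κ :* κ :* v := κ :* v :* κ) refl κ v) ⟩
      1# + κ * v * κ   <⟨ +-monoʳ-< 1# (*-monoʳ-< (*-pos 0<κ 0<v) κ<1) ⟩
      1# + κ * v * 1#  ≈⟨ +-congˡ (solve 3 (λ κ v i → κ :* v :* i := i :* v :* κ) refl κ v 1#) ⟩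
      1# + 1# * v * κ  ≈⟨ +-congˡ (*-congʳ (*-identityˡ v)) ⟩
      1# + v * κ       <⟨ +-monoʳ-< 1# (*-monoʳ-< 0<v κ<1) ⟩
      1# + v * 1#      ≈⟨ +-congˡ (*-identityʳ v) ⟩
      1# + v           ∎

  -- The left-hand side is the variance of a variable that is q with probability
  -- p and 0 with probability p′; its mean is p q = 1.
  two-point-variance : ∀ {p p′ q} → p + p′ ≈ 1# → p * q ≈ 1# →
    p * ((q - 1#) * (q - 1#)) + p′ * ((0# - 1#) * (0# - 1#)) ≈ q - 1#
  two-point-variance {p} {p′} {q} p+p′≈1 pq≈1 = begin-equality
    p * (w * w) + p′ * ((0# - 1#) * (0# - 1#))
      ≈⟨ +-congˡ (*-congˡ [0-1]²≈1) ⟩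
    p * (w * w) + p′ * 1#
      ≈⟨ +-congˡ (*-identityʳ p′) ⟩
    p * (w * w) + p′
      ≈⟨ +-congˡ pw≈p′ ⟨
    p * (w * w) + p * w
      ≈⟨ solve 2 (λ p w → p :* (w :* w) :+ p :* w := p :* w :* w :+ p :* w) refl p w ⟩
    p * w * w + p * w
      ≈⟨ +-congʳ (*-congʳ pw≈p′) ⟩
    p′ * w + p * w
      ≈⟨ solve 3 (λ p p′ w → p′ :* w :+ p :* w := (p :+ p′) :* w) refl p p′ w ⟩
    (p + p′) * w
      ≈⟨ *-congʳ p+p′≈1 ⟩
    1# * w
      ≈⟨ *-identityˡ w ⟩
    w ∎
    where
    w = q - 1#

    [0-1]²≈1 : (0# - 1#) * (0# - 1#) ≈ 1#
    [0-1]²≈1 = begin-equality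
      (0# - 1#) * (0# - 1#) ≈⟨ *-cong (+-identityˡ (- 1#)) (+-identityˡ (- 1#)) ⟩
      - 1# * - 1#           ≈⟨ R.-1*x≈-x (- 1#) ⟩
      - - 1#                ≈⟨ R.-‿involutive 1# ⟩
      1#                    ∎

    pw≈p′ : p * w ≈ p′
    pw≈p′ = +-cancelʳ p $ begin-equality
      p * w + p      ≈⟨ +-congˡ (*-identityʳ p) ⟨
      p * w + p * 1# ≈⟨ distribˡ p w 1# ⟨
      p * (w + 1#)   ≈⟨ *-congˡ (-‿+-cancel q 1#) ⟩
      p * q          ≈⟨ pq≈1 ⟩
      1#             ≈⟨ p+p′≈1 ⟨
      p + p′         ≈⟨ +-comm p p′ ⟩
      p′ + p         ∎

-- Properties holding in every outcome of a random computation

-- Every leaf of a decision tree has positive probability, so this is the meaning of "almost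
-- surely". It lets pathwise invariants be used under the expectation, through `𝔼-cong`.
AllOutcomes : ∀ {a ℓ} {A : Set a} → (A → Set ℓ) → Prob A → Set ℓ
AllOutcomes P (return x)    = P x
AllOutcomes P (uniform n k) = ∀ i → AllOutcomes P (k i)

AllOutcomes-universal : ∀ {a ℓ} {A : Set a} {P : A → Set ℓ} → (∀ x → P x) →
                        ∀ p → AllOutcomes P p
AllOutcomes-universal u (return x)    = u x
AllOutcomes-universal u (uniform n k) = λ i → AllOutcomes-universal u (k i)

AllOutcomes-map : ∀ {a ℓ ℓ′} {A : Set a} {P : A → Set ℓ} {Q : A → Set ℓ′} →
                  (∀ {x} → P x → Q x) → ∀ p → AllOutcomes P p → AllOutcomes Q p
AllOutcomes-map f (return x)    Px = f Px
AllOutcomes-map f (uniform n k) Pk = λ i → AllOutcomes-map f (k i) (Pk i)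

AllOutcomes-zip : ∀ {a ℓ ℓ′} {A : Set a} {P : A → Set ℓ} {Q : A → Set ℓ′} →
                  ∀ p → AllOutcomes P p → AllOutcomes Q p → AllOutcomes (λ x → P x × Q x) p
AllOutcomes-zip (return x)    Px Qx = Px , Qx
AllOutcomes-zip (uniform n k) Pk Qk = λ i → AllOutcomes-zip (k i) (Pk i) (Qk i)

AllOutcomes-bind : ∀ {a b ℓ ℓ′} {A : Set a} {B : Set b} {P : A → Set ℓ} {Q : B → Set ℓ′}
                   {f : A → Prob B} → (∀ {x} → P x → AllOutcomes Q (f x)) →
                   ∀ p → AllOutcomes P p → AllOutcomes Q (p >>= f)
AllOutcomes-bind h (return x)    Px = h Px
AllOutcomes-bind h (uniform n k) Pk = λ i → AllOutcomes-bind h (k i) (Pk i)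

-- Expectation, variance and indicators

module ExpectationProperties {c ℓ₁ ℓ₂} (K : OrderedField c ℓ₁ ℓ₂) where
  open OrderedField K hiding (zero)
  open OrderedFieldProperties K
  open Expectation K
  open SemiringSum semiring
    using (sum; sum-cong-≋; ∑-distrib-+; *-distribˡ-sum; sum-replicate)
  open SemiringMult semiring using (×-assoc-*; ×-congʳ) renaming (_×_ to _×ᶠ_)
  open Solver using (solve; _:=_; _:+_; _:*_)
  open <-Reasoning

  𝔼-cong : ∀ {a} {A : Set a} (p : Prob A) {f g : A → Carrier} →
           AllOutcomes (λ x → f x ≈ g x) p → 𝔼 p f ≈ 𝔼 p g
  𝔼-cong (return x)    f≈g = f≈g
  𝔼-cong (uniform n k) f≈g = *-congʳ (sum-cong-≋ (λ i → 𝔼-cong (k i) (f≈g i)))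

  𝔼-cong′ : ∀ {a} {A : Set a} (p : Prob A) {f g : A → Carrier} →
            (∀ x → f x ≈ g x) → 𝔼 p f ≈ 𝔼 p g
  𝔼-cong′ p f≈g = 𝔼-cong p (AllOutcomes-universal f≈g p)

  𝔼->>= : ∀ {a b} {A : Set a} {B : Set b} (p : Prob A) (k : A → Prob B) (f : B → Carrier) →
          𝔼 (p >>= k) f ≈ 𝔼 p (λ x → 𝔼 (k x) f)
  𝔼->>= (return x)    h f = refl
  𝔼->>= (uniform n k) h f = *-congʳ (sum-cong-≋ (λ i → 𝔼->>= (k i) h f))

  𝔼-+ : ∀ {a} {A : Set a} (p : Prob A) (f g : A → Carrier) →
        𝔼 p (λ x → f x + g x) ≈ 𝔼 p f + 𝔼 p g
  𝔼-+ (return x)    f g = refl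
  𝔼-+ (uniform n k) f g = begin-equality
    sum (λ i → 𝔼 (k i) (λ x → f x + g x)) * fromℕ (suc n) ⁻¹
      ≈⟨ *-congʳ (sum-cong-≋ (λ i → 𝔼-+ (k i) f g)) ⟩
    sum (λ i → 𝔼 (k i) f + 𝔼 (k i) g) * fromℕ (suc n) ⁻¹
      ≈⟨ *-congʳ (∑-distrib-+ (λ i → 𝔼 (k i) f) (λ i → 𝔼 (k i) g)) ⟩
    (sum (λ i → 𝔼 (k i) f) + sum (λ i → 𝔼 (k i) g)) * fromℕ (suc n) ⁻¹
      ≈⟨ distribʳ _ _ _ ⟩
    𝔼 (uniform n k) f + 𝔼 (uniform n k) g ∎

  𝔼-*ˡ : ∀ {a} {A : Set a} (p : Prob A) (x : Carrier) (f : A → Carrier) →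
         𝔼 p (λ y → x * f y) ≈ x * 𝔼 p f
  𝔼-*ˡ (return y)    x f = refl
  𝔼-*ˡ (uniform n k) x f = begin-equality
    sum (λ i → 𝔼 (k i) (λ y → x * f y)) * fromℕ (suc n) ⁻¹
      ≈⟨ *-congʳ (sum-cong-≋ (λ i → 𝔼-*ˡ (k i) x f)) ⟩
    sum (λ i → x * 𝔼 (k i) f) * fromℕ (suc n) ⁻¹
      ≈⟨ *-congʳ (*-distribˡ-sum x (λ i → 𝔼 (k i) f)) ⟨
    x * sum (λ i → 𝔼 (k i) f) * fromℕ (suc n) ⁻¹
      ≈⟨ *-assoc _ _ _ ⟩
    x * 𝔼 (uniform n k) f ∎

  𝔼-*ʳ : ∀ {a} {A : Set a} (p : Prob A) (x : Carrier) (f : A → Carrier) →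
         𝔼 p (λ y → f y * x) ≈ 𝔼 p f * x
  𝔼-*ʳ p x f = begin-equality
    𝔼 p (λ y → f y * x) ≈⟨ 𝔼-cong′ p (λ y → *-comm (f y) x) ⟩
    𝔼 p (λ y → x * f y) ≈⟨ 𝔼-*ˡ p x f ⟩
    x * 𝔼 p f           ≈⟨ *-comm x (𝔼 p f) ⟩
    𝔼 p f * x           ∎

  sum-const : ∀ n x → sum {n} (λ _ → x) ≈ fromℕ n * x
  sum-const n x = begin-equality
    sum {n} (λ _ → x)  ≈⟨ sum-replicate n ⟩
    n ×ᶠ x             ≈⟨ ×-congʳ n (*-identityˡ x) ⟨
    n ×ᶠ (1# * x)      ≈⟨ ×-assoc-* n 1# x ⟨
    fromℕ n * x        ∎

  𝔼-const : ∀ {a} {A : Set a} (p : Prob A) (x : Carrier) → 𝔼 p (λ _ → x) ≈ x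
  𝔼-const (return y)    x = refl
  𝔼-const (uniform n k) x = begin-equality
    sum (λ i → 𝔼 (k i) (λ _ → x)) * fromℕ (suc n) ⁻¹
      ≈⟨ *-congʳ (sum-cong-≋ (λ i → 𝔼-const (k i) x)) ⟩
    sum {suc n} (λ _ → x) * fromℕ (suc n) ⁻¹
      ≈⟨ *-congʳ (sum-const (suc n) x) ⟩
    fromℕ (suc n) * x * fromℕ (suc n) ⁻¹
      ≈⟨ solve 3 (λ a b c → a :* b :* c := a :* c :* b) refl (fromℕ (suc n)) x (fromℕ (suc n) ⁻¹) ⟩
    fromℕ (suc n) * fromℕ (suc n) ⁻¹ * x
      ≈⟨ *-congʳ (fromℕ-inverseʳ n) ⟩
    1# * x
      ≈⟨ *-identityˡ x ⟩
    x ∎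

  Var-scale : ∀ {a} {A : Set a} (p : Prob A) {κ : Carrier} {X Y : A → Carrier} →
              (∀ x → Y x ≈ κ * X x) → Var p Y ≈ κ * κ * Var p X
  Var-scale p {κ} {X} {Y} Y≈κX = begin-equality
    𝔼 p (λ x → (Y x - 𝔼 p Y) * (Y x - 𝔼 p Y))
      ≈⟨ 𝔼-cong′ p (λ x → *-cong (deviation x) (deviation x)) ⟩
    𝔼 p (λ x → κ * (X x - 𝔼 p X) * (κ * (X x - 𝔼 p X)))
      ≈⟨ 𝔼-cong′ p (λ x → solve 2 (λ κ d → κ :* d :* (κ :* d) := κ :* κ :* (d :* d)) refl κ (X x - 𝔼 p X)) ⟩
    𝔼 p (λ x → κ * κ * ((X x - 𝔼 p X) * (X x - 𝔼 p X)))
      ≈⟨ 𝔼-*ˡ p (κ * κ) _ ⟩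
    κ * κ * Var p X ∎
    where
    deviation : ∀ x → Y x - 𝔼 p Y ≈ κ * (X x - 𝔼 p X)
    deviation x = begin-equality
      Y x - 𝔼 p Y         ≈⟨ +-cong (Y≈κX x) (-‿cong (trans (𝔼-cong′ p Y≈κX) (𝔼-*ˡ p κ X))) ⟩
      κ * X x - κ * 𝔼 p X ≈⟨ R.x[y-z]≈xy-xz κ (X x) (𝔼 p X) ⟨
      κ * (X x - 𝔼 p X)   ∎

  Var-cong : ∀ {a} {A : Set a} (p : Prob A) (X : A → Carrier) {μ : Carrier} → 𝔼 p X ≈ μ →
             Var p X ≈ 𝔼 p (λ x → (X x - μ) * (X x - μ))
  Var-cong p X EX≈μ = 𝔼-cong′ p λ x → *-cong (+-congˡ (-‿cong EX≈μ)) (+-congˡ (-‿cong EX≈μ))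

  𝟙 : ∀ {a} {A : Set a} → Dec A → Carrier
  𝟙 A? = if does A? then 1# else 0#

  𝟙-⇔ : ∀ {a b} {A : Set a} {B : Set b} → A ⇔ B → (A? : Dec A) (B? : Dec B) → 𝟙 A? ≈ 𝟙 B?
  𝟙-⇔ A⇔B A? B? = reflexive (≡.cong (if_then 1# else 0#) (does-⇔ A⇔B A? B?))

  𝟙-true : ∀ {a} {A : Set a} → A → (A? : Dec A) → 𝟙 A? ≈ 1#
  𝟙-true x (yes _) = refl
  𝟙-true x (no ¬x) = contradiction x ¬x

  𝟙-false : ∀ {a} {A : Set a} → ¬ A → (A? : Dec A) → 𝟙 A? ≈ 0#
  𝟙-false ¬x (yes x) = contradiction x ¬x
  𝟙-false ¬x (no _)  = refl

  𝟙-complement : ∀ {a} {A : Set a} (A? : Dec A) → 𝟙 A? + 𝟙 (¬? A?) ≈ 1#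
  𝟙-complement (yes _) = +-identityʳ 1#
  𝟙-complement (no _)  = +-identityˡ 1#

  𝟙-∖ : ∀ {a b} {A : Set a} {B : Set b} (A? : Dec A) (B? : Dec B) → (B → A) →
        𝟙 (A? ×-dec ¬? B?) + 𝟙 B? ≈ 𝟙 A?
  𝟙-∖ (yes _) (yes _) _   = +-identityˡ 1#
  𝟙-∖ (no ¬a) (yes b) B⇒A = contradiction (B⇒A b) ¬a
  𝟙-∖ (yes _) (no _)  _   = +-identityʳ 1#
  𝟙-∖ (no _)  (no _)  _   = +-identityʳ 0#

  sum-𝟙-< : ∀ {m n} → m ℕ.≤ n → sum {n} (λ i → 𝟙 (toℕ i ℕ.<? m)) ≈ fromℕ m
  sum-𝟙-< {zero}  {n}     _         = trans (sum-const n 0#) (zeroʳ (fromℕ n))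
  sum-𝟙-< {suc m} {suc n} (s≤s m≤n) = +-congˡ (sum-𝟙-< m≤n)

  sum-𝟙-≡ : ∀ {m n} → m ℕ.< n → sum {n} (λ i → 𝟙 (toℕ i ℕ.≟ m)) ≈ 1#
  sum-𝟙-≡ {zero}  {suc n} _         =
    trans (+-congˡ (trans (sum-const n 0#) (zeroʳ (fromℕ n)))) (+-identityʳ 1#)
  sum-𝟙-≡ {suc m} {suc n} (s≤s m<n) = trans (+-identityˡ _) (sum-𝟙-≡ m<n)

  -- The sum counts the indices that satisfy P, and striking out one of them lowers the count by
  -- one; with `0 < N` the truncated subtraction is exact. Started from the full range or from an
  -- initial segment, it counts the favourable draws in the transition probabilities.
  sum-𝟙-delete : ∀ {ℓ n N m} {P : ℕ → Set ℓ} (P? : ∀ i → Dec (P i)) → m ℕ.< n → P m → 0 ℕ.< N →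
                 sum {n} (λ i → 𝟙 (P? (toℕ i))) ≈ fromℕ N →
                 sum {n} (λ i → 𝟙 (P? (toℕ i) ×-dec ¬? (toℕ i ℕ.≟ m))) ≈ fromℕ (N ∸ 1)
  sum-𝟙-delete {n = n} {suc N} {m} P? m<n Pm _ total = +-cancelʳ 1# $ begin-equality
    sum {n} (λ i → 𝟙 (P? (toℕ i) ×-dec ¬? (toℕ i ℕ.≟ m))) + 1#
      ≈⟨ +-congˡ (sum-𝟙-≡ m<n) ⟨
    sum {n} (λ i → 𝟙 (P? (toℕ i) ×-dec ¬? (toℕ i ℕ.≟ m))) + sum {n} (λ i → 𝟙 (toℕ i ℕ.≟ m))
      ≈⟨ ∑-distrib-+ {n} (λ i → 𝟙 (P? (toℕ i) ×-dec ¬? (toℕ i ℕ.≟ m))) (λ i → 𝟙 (toℕ i ℕ.≟ m)) ⟨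
    sum {n} (λ i → 𝟙 (P? (toℕ i) ×-dec ¬? (toℕ i ℕ.≟ m)) + 𝟙 (toℕ i ℕ.≟ m))
      ≈⟨ sum-cong-≋ {n} (λ i → split (toℕ i)) ⟩
    sum {n} (λ i → 𝟙 (P? (toℕ i)))
      ≈⟨ total ⟩
    1# + fromℕ N
      ≈⟨ +-comm 1# (fromℕ N) ⟩
    fromℕ N + 1# ∎
    where
    split : ∀ i → 𝟙 (P? i ×-dec ¬? (i ℕ.≟ m)) + 𝟙 (i ℕ.≟ m) ≈ 𝟙 (P? i)
    split i = 𝟙-∖ (P? i) (i ℕ.≟ m) λ { ≡.refl → Pm }

-- Undirected equality of edges, vector lookup and branches

~-sym : ∀ {v} {V : Set v} {e f : Edge V} → e ~ f → f ~ e
~-sym (inj₁ e≡f)  = inj₁ (≡.sym e≡f)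
~-sym (inj₂ e≡f′) = inj₂ (≡.cong swap (≡.sym e≡f′))

~-trans : ∀ {v} {V : Set v} {e f g : Edge V} → e ~ f → f ~ g → e ~ g
~-trans (inj₁ ≡.refl) f~g           = f~g
~-trans (inj₂ ≡.refl) (inj₁ ≡.refl) = inj₂ ≡.refl
~-trans (inj₂ ≡.refl) (inj₂ ≡.refl) = inj₁ ≡.refl

any-lookup⁺ : ∀ {a p n} {A : Set a} {P : A → Set p} (xs : Vec A n) i → P (lookup xs i) → Vec.Any P xs
any-lookup⁺ (x ∷ xs) fzero    px = Vec.here px
any-lookup⁺ (x ∷ xs) (fsuc i) px = Vec.there (any-lookup⁺ xs i px)

arity : ∀ {a} {A : Set a} → Prob A → ℕ
arity (return _)    = 0
arity (uniform n _) = n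

branch : ∀ {a} {A : Set a} (p : Prob A) → Fin (suc (arity p)) → Prob A
branch (return x)    _ = return x
branch (uniform _ k) i = k i

-- Reservoir sampling: slots, replacement and invariants

module Reservoir {c ℓ₁ ℓ₂ v} (K : OrderedField c ℓ₁ ℓ₂) {V : Set v} (_≟_ : DecidableEquality V)
                 (M : ℕ) {N : ℕ} (S : SimpleStream V N) where
  open OrderedField K hiding (zero)
  open OrderedFieldProperties K
  open Expectation K
  open ExpectationProperties K
  open FURL-S K _≟_ M
  open SimpleStream S
  open SemiringSum semiring using (sum; sum-cong-≋)
  open Solver using (solve; _:=_; _:+_; _:*_)
  open <-Reasoning

  -- Restates the local replacement function of `sample` in a form that also covers the filling
  -- phase, in which item k goes to slot k. Invariants then need only one preservation proof for
  -- both phases.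
  overwrite : Buffer → Edge V → ℕ → Buffer
  overwrite D e i with i ℕ.<? M
  ... | yes i<M = D [ fromℕ< i<M ]≔ just e
  ... | no  _   = D

  lookup-overwrite : ∀ D e {i} a → toℕ a ≡ i → lookup (overwrite D e i) a ≡ just e
  lookup-overwrite D e {i} a a≡i with i ℕ.<? M
  ... | no  i≮M = contradiction (≡.subst (ℕ._< M) a≡i (toℕ<n a)) i≮M
  ... | yes i<M with ≡.refl ← toℕ-injective (≡.trans (toℕ-fromℕ< i<M) (≡.sym a≡i)) =
    lookup∘update (fromℕ< i<M) D (just e)

  lookup-overwrite′ : ∀ D e {i} a → toℕ a ≢ i → lookup (overwrite D e i) a ≡ lookup D a
  lookup-overwrite′ D e {i} a a≢i with i ℕ.<? M
  ... | no  _   = ≡.refl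
  ... | yes i<M = lookup∘update′ (λ { ≡.refl → a≢i (toℕ-fromℕ< i<M) }) D (just e)

  sample-fill : ∀ {k} e D → k ℕ.< M → sample k e D ≡ return (overwrite D e k)
  sample-fill {k} e D k<M with k ℕ.<? M
  ... | yes _   = ≡.refl
  ... | no  k≮M = contradiction k<M k≮M

  -- `branch` serves to name the outcomes, which `sample` computes by a local
  -- function of Defs.
  branch-sample : ∀ {k} e D → ¬ (k ℕ.< M) → (i : Fin (suc (arity (sample k e D)))) →
                  branch (sample k e D) i ≡ return (overwrite D e (toℕ i))
  branch-sample {k} e D k≮M i with k ℕ.<? M
  ... | yes k<M = contradiction k<M k≮M
  ... | no _ with toℕ i ℕ.<? M
  ...   | yes _ = ≡.refl
  ...   | no  _ = ≡.refl

  𝔼-sample : ∀ {k} e D (F : Buffer → Carrier) → ¬ (k ℕ.< M) →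
             𝔼 (sample k e D) F ≈
             sum {suc k} (λ i → F (overwrite D e (toℕ i))) * fromℕ (suc k) ⁻¹
  -- `branch-sample` is abstracted together with the decision, so that its type reduces along with
  -- `sample` and the number of branches becomes visible.
  𝔼-sample {k} e D F k≮M with k ℕ.<? M | branch-sample {k} e D k≮M
  ... | yes k<M | _      = contradiction k<M k≮M
  ... | no _    | branch = *-congʳ $ sum-cong-≋ {suc k} λ i →
    reflexive (≡.cong (λ p → 𝔼 p F) (branch i))

  all-sample : ∀ {ℓ} {P : Buffer → Set ℓ} k e D → (∀ i → P (overwrite D e i)) →
               AllOutcomes P (sample k e D)
  all-sample {P = P} k e D all = by-cases (k ℕ.<? M)
    where
    all-draw : ¬ (k ℕ.< M) → AllOutcomes P (sample k e D)
    all-draw k≮M with k ℕ.<? M | branch-sample {k} e D k≮M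
    ... | yes k<M | _      = contradiction k<M k≮M
    ... | no  _   | branch = λ i →
      ≡.subst (AllOutcomes P) (≡.sym (branch i)) (all (toℕ i))

    by-cases : Dec (k ℕ.< M) → AllOutcomes P (sample k e D)
    by-cases (yes k<M) = ≡.subst (AllOutcomes P) (≡.sym (sample-fill e D k<M)) (all k)
    by-cases (no k≮M)  = all-draw k≮M

  -- Membership refined by its slot: an edge known to sit in slot a is lost for precisely one draw,
  -- i = a.
  Holds : Buffer → Fin M → Edge V → Set v
  Holds D a f = Maybe.Any (f ~_) (lookup D a)

  ∈⇒Holds : ∀ {f D} → f ∈ D → ∃ λ a → Holds D a f
  ∈⇒Holds f∈D = Vec.index f∈D , Vec.lookup-index f∈D

  Holds⇒∈ : ∀ {f D a} → Holds D a f → f ∈ D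
  Holds⇒∈ {D = D} {a} = any-lookup⁺ D a

  overwrite-holds : ∀ {D e i f} a → toℕ a ≡ i → f ~ e → Holds (overwrite D e i) a f
  overwrite-holds {D} {e} {i} {f} a a≡i f~e =
    ≡.subst (Maybe.Any (f ~_)) (≡.sym (lookup-overwrite D e a a≡i)) (Maybe.just f~e)

  overwrite-holds′ : ∀ {D e i f} a → toℕ a ≢ i → Holds D a f → Holds (overwrite D e i) a f
  overwrite-holds′ {D} {e} {i} {f} a a≢i =
    ≡.subst (Maybe.Any (f ~_)) (≡.sym (lookup-overwrite′ D e a a≢i))

  holds-overwrite : ∀ {D e i f} a → Holds (overwrite D e i) a f →
                    (toℕ a ≡ i × f ~ e) ⊎ (toℕ a ≢ i × Holds D a f)
  holds-overwrite {D} {e} {i} {f} a h with toℕ a ℕ.≟ i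
  ... | yes a≡i = inj₁ (a≡i , Maybe.drop-just (≡.subst (Maybe.Any (f ~_)) (lookup-overwrite D e a a≡i) h))
  ... | no  a≢i = inj₂ (a≢i , ≡.subst (Maybe.Any (f ~_)) (lookup-overwrite′ D e a a≢i) h)

  holds-~ : ∀ {D a f g} → Holds D a f → Holds D a g → f ~ g
  holds-~ {D} {a} h h′ with lookup D a
  holds-~ (Maybe.just f~e) (Maybe.just g~e) | just _ = ~-trans f~e (~-sym g~e)

  edge-injective : ∀ {f i j} → f ~ edge i → f ~ edge j → i ≡ j
  edge-injective f~i f~j = distinct _ _ (~-trans (~-sym f~i) f~j)

  -- The pathwise invariant. `arrived` guarantees that an arriving edge is not yet held, so that it
  -- is present afterwards only if it was drawn in; `unique` guarantees that replacing a single slot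
  -- really removes an old edge.
  record Valid (k : ℕ) (D : Buffer) : Set v where
    field
      arrived : ∀ {a f} → Holds D a f → ∀ {j} → k ℕ.≤ toℕ j → ¬ (f ~ edge j)
      unique  : ∀ {a b f} → Holds D a f → Holds D b f → a ≡ b

    ∈-arrived : ∀ {f} → f ∈ D → ∀ {j} → k ℕ.≤ toℕ j → ¬ (f ~ edge j)
    ∈-arrived f∈D = arrived (proj₂ (∈⇒Holds f∈D))

  valid-initial : Valid 0 (replicate M nothing)
  valid-initial = record { arrived = λ h → ⊥-elim (empty h) ; unique = λ h → ⊥-elim (empty h) }
    where
    empty : ∀ {a f} → ¬ Holds (replicate M nothing) a f
    empty {a} {f} h with () ← ≡.subst (Maybe.Any (f ~_)) (lookup-replicate a nothing) h

  -- One arrival with the earlier buffer D fixed: the expectations computed here are conditional on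
  -- D.
  module Arrival {k} (j : Fin N) (j≡k : toℕ j ≡ k) {D} (valid : Valid k D) where
    open Valid valid

    not-held : ∀ {a f} → Holds D a f → ¬ (f ~ edge j)
    not-held h = arrived h (ℕ.≤-reflexive (≡.sym j≡k))

    valid-overwrite : ∀ i → Valid (suc k) (overwrite D (edge j) i)
    valid-overwrite i = record { arrived = arrived′ ; unique = unique′ }
      where
      arrived′ : ∀ {a f} → Holds (overwrite D (edge j) i) a f →
                 ∀ {l} → suc k ℕ.≤ toℕ l → ¬ (f ~ edge l)
      arrived′ {a} h k<l f~l with holds-overwrite a h
      ... | inj₁ (_ , f~j) = ℕ.<⇒≢ k<l (≡.trans (≡.sym j≡k) (≡.cong toℕ (edge-injective f~j f~l)))
      ... | inj₂ (_ , h′)  = arrived h′ (ℕ.<⇒≤ k<l) f~l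

      unique′ : ∀ {a b f} → Holds (overwrite D (edge j) i) a f →
                Holds (overwrite D (edge j) i) b f → a ≡ b
      unique′ {a} {b} h h′ with holds-overwrite a h | holds-overwrite b h′
      ... | inj₁ (a≡i , _)   | inj₁ (b≡i , _)   = toℕ-injective (≡.trans a≡i (≡.sym b≡i))
      ... | inj₁ (_ , f~j)   | inj₂ (_ , held)  = contradiction f~j (not-held held)
      ... | inj₂ (_ , held)  | inj₁ (_ , f~j)   = contradiction f~j (not-held held)
      ... | inj₂ (_ , held)  | inj₂ (_ , held′) = unique held held′

    new∈overwrite : ∀ {f} i → f ~ edge j → f ∈ overwrite D (edge j) i ⇔ i ℕ.< M
    new∈overwrite {f} i f~j = mk⇔ to λ i<M →
        Holds⇒∈ (overwrite-holds (fromℕ< i<M) (toℕ-fromℕ< i<M) f~j)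
      where
      to : f ∈ overwrite D (edge j) i → i ℕ.< M
      to f∈ with a , h ← ∈⇒Holds f∈ with holds-overwrite a h
      ... | inj₁ (≡.refl , _) = toℕ<n a
      ... | inj₂ (_ , held)   = contradiction f~j (not-held held)

    old∈overwrite : ∀ {f a} i → Holds D a f → f ∈ overwrite D (edge j) i ⇔ i ≢ toℕ a
    old∈overwrite {f} {a} i held = mk⇔ to λ i≢a →
        Holds⇒∈ (overwrite-holds′ a (i≢a ∘ ≡.sym) held)
      where
      to : f ∈ overwrite D (edge j) i → i ≢ toℕ a
      to f∈ with b , h ← ∈⇒Holds f∈ with holds-overwrite b h
      ... | inj₁ (_ , f~j)      = contradiction f~j (not-held held)
      ... | inj₂ (b≢i , held′) with ≡.refl ← unique held held′ = b≢i ∘ ≡.sym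

    absent∉overwrite : ∀ {f} i → ¬ (f ~ edge j) → ¬ (f ∈ D) → ¬ (f ∈ overwrite D (edge j) i)
    absent∉overwrite i f≁j f∉D f∈ with a , h ← ∈⇒Holds f∈ with holds-overwrite a h
    ... | inj₁ (_ , f~j)  = f≁j f~j
    ... | inj₂ (_ , held) = f∉D (Holds⇒∈ held)

    -- Transition probabilities of one step after the filling phase

    module _ (M≤k : M ℕ.≤ k) where
      private
        1/[1+k] : Carrier
        1/[1+k] = fromℕ (suc k) ⁻¹

        slot<1+k : ∀ (a : Fin M) → toℕ a ℕ.< suc k
        slot<1+k a = ℕ.<-trans (toℕ<n a) (s≤s M≤k)

        0<M : Fin M → 0 ℕ.< M
        0<M a = ℕ.≤-<-trans z≤n (toℕ<n a)

        sum-𝟙-≢ : ∀ a → sum {suc k} (λ i → 𝟙 (¬? (toℕ i ℕ.≟ toℕ {M} a))) ≈ fromℕ k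
        sum-𝟙-≢ a = sum-𝟙-delete {N = suc k} (λ _ → yes tt) (slot<1+k a) tt ℕ.z<s
          (trans (sum-const (suc k) 1#) (*-identityʳ (fromℕ (suc k))))

      -- Reduces a transition probability to counting: once D is fixed, the event depends on the
      -- draw alone, through a condition Q on i.
      𝔼-sample-𝟙 : ∀ {ℓ ℓ′} {P : Buffer → Set ℓ} {Q : ℕ → Set ℓ′} {x}
        (P? : ∀ D → Dec (P D)) (Q? : ∀ i → Dec (Q i)) →
        (∀ i → P (overwrite D (edge j) i) ⇔ Q i) →
        sum {suc k} (λ i → 𝟙 (Q? (toℕ i))) ≈ x →
        𝔼 (sample k (edge j) D) (λ D → 𝟙 (P? D)) ≈ x * 1/[1+k]
      𝔼-sample-𝟙 {x = x} P? Q? P⇔Q total = begin-equality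
        𝔼 (sample k (edge j) D) (λ D → 𝟙 (P? D))
          ≈⟨ 𝔼-sample (edge j) D (λ D → 𝟙 (P? D)) (ℕ.≤⇒≯ M≤k) ⟩
        sum {suc k} (λ i → 𝟙 (P? (overwrite D (edge j) (toℕ i)))) * 1/[1+k]
          ≈⟨ *-congʳ (sum-cong-≋ {suc k} λ i →
               𝟙-⇔ (P⇔Q (toℕ i)) (P? (overwrite D (edge j) (toℕ i))) (Q? (toℕ i))) ⟩
        sum {suc k} (λ i → 𝟙 (Q? (toℕ i))) * 1/[1+k]
          ≈⟨ *-congʳ total ⟩
        x * 1/[1+k] ∎

      -- Zero is given as `0# * x` to match the vanishing indicator factor in the transition
      -- formulas.
      𝔼-sample-𝟙-false : ∀ {ℓ} {P : Buffer → Set ℓ} {x} (P? : ∀ D → Dec (P D)) →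
        (∀ i → ¬ P (overwrite D (edge j) i)) →
        𝔼 (sample k (edge j) D) (λ D → 𝟙 (P? D)) ≈ 0# * x
      𝔼-sample-𝟙-false {x = x} P? ¬P = begin-equality
        𝔼 (sample k (edge j) D) (λ D → 𝟙 (P? D))
          ≈⟨ 𝔼-sample-𝟙 P? (λ _ → no λ ()) (λ i → mk⇔ (¬P i) λ ())
                       (trans (sum-const (suc k) 0#) (zeroʳ (fromℕ (suc k)))) ⟩
        0# * 1/[1+k] ≈⟨ zeroˡ 1/[1+k] ⟩
        0#           ≈⟨ zeroˡ x ⟨
        0# * x       ∎

      𝔼-sample-new : ∀ {f} → f ~ edge j →
        𝔼 (sample k (edge j) D) (λ D → 𝟙 (f ∈? D)) ≈ fromℕ M * 1/[1+k]
      𝔼-sample-new {f} f~j = 𝔼-sample-𝟙 (f ∈?_) (ℕ._<? M) (λ i → new∈overwrite i f~j)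
        (sum-𝟙-< (ℕ.m≤n⇒m≤1+n M≤k))

      𝔼-sample-old : ∀ {f} → ¬ (f ~ edge j) →
        𝔼 (sample k (edge j) D) (λ D → 𝟙 (f ∈? D)) ≈ 𝟙 (f ∈? D) * (fromℕ k * 1/[1+k])
      𝔼-sample-old {f} f≁j with f ∈? D
      ... | no f∉D  = 𝔼-sample-𝟙-false (f ∈?_) (λ i → absent∉overwrite i f≁j f∉D)
      ... | yes f∈D with a , held ← ∈⇒Holds f∈D = trans
        (𝔼-sample-𝟙 (f ∈?_) (λ i → ¬? (i ℕ.≟ toℕ a)) (λ i → old∈overwrite i held) (sum-𝟙-≢ a))
        (sym (*-identityˡ _))

      -- The new edge enters for the M draws i < M, and one of these evicts f. The indicator on the
      -- right concerns f alone, which is where the pair recursion passes to single edges.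
      𝔼-sample-old-new : ∀ {f g} → ¬ (f ~ edge j) → g ~ edge j →
        𝔼 (sample k (edge j) D) (λ D → 𝟙 ((f ∈? D) ×-dec (g ∈? D))) ≈
        𝟙 (f ∈? D) * (fromℕ (M ∸ 1) * 1/[1+k])
      𝔼-sample-old-new {f} {g} f≁j g~j with f ∈? D
      ... | no f∉D  = 𝔼-sample-𝟙-false (λ D → (f ∈? D) ×-dec (g ∈? D))
        (λ i → absent∉overwrite i f≁j f∉D ∘ proj₁)
      ... | yes f∈D with a , held ← ∈⇒Holds f∈D = trans
        (𝔼-sample-𝟙 (λ D → (f ∈? D) ×-dec (g ∈? D)) (λ i → (i ℕ.<? M) ×-dec ¬? (i ℕ.≟ toℕ a))
          (λ i → mk⇔
            (λ (f∈ , g∈) → to (new∈overwrite i g~j) g∈ , to (old∈overwrite i held) f∈)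
            (λ (i<M , i≢a) → from (old∈overwrite i held) i≢a , from (new∈overwrite i g~j) i<M))
          (sum-𝟙-delete (ℕ._<? M) (slot<1+k a) (toℕ<n a) (0<M a) (sum-𝟙-< (ℕ.m≤n⇒m≤1+n M≤k))))
        (sym (*-identityˡ _))
        where open Equivalence

      -- Distinct edges occupy distinct slots, so two of the k + 1 draws destroy the pair and k - 1
      -- keep it.
      𝔼-sample-old-old : ∀ {f g} → ¬ (f ~ g) → ¬ (f ~ edge j) → ¬ (g ~ edge j) →
        𝔼 (sample k (edge j) D) (λ D → 𝟙 ((f ∈? D) ×-dec (g ∈? D))) ≈
        𝟙 ((f ∈? D) ×-dec (g ∈? D)) * (fromℕ (k ∸ 1) * 1/[1+k])
      𝔼-sample-old-old {f} {g} f≁g f≁j g≁j with f ∈? D | g ∈? D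
      ... | no f∉D  | _       = 𝔼-sample-𝟙-false (λ D → (f ∈? D) ×-dec (g ∈? D))
        (λ i → absent∉overwrite i f≁j f∉D ∘ proj₁)
      ... | yes _   | no g∉D  = 𝔼-sample-𝟙-false (λ D → (f ∈? D) ×-dec (g ∈? D))
        (λ i → absent∉overwrite i g≁j g∉D ∘ proj₂)
      ... | yes f∈D | yes g∈D with a , f-held ← ∈⇒Holds f∈D | b , g-held ← ∈⇒Holds g∈D = trans
        (𝔼-sample-𝟙 (λ D → (f ∈? D) ×-dec (g ∈? D))
          (λ i → ¬? (i ℕ.≟ toℕ a) ×-dec ¬? (i ℕ.≟ toℕ b))
          (λ i → mk⇔
            (λ (f∈ , g∈) → to (old∈overwrite i f-held) f∈ , to (old∈overwrite i g-held) g∈)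
            (λ (i≢a , i≢b) → from (old∈overwrite i f-held) i≢a , from (old∈overwrite i g-held) i≢b))
          (sum-𝟙-delete (λ i → ¬? (i ℕ.≟ toℕ a)) (slot<1+k b) b≢a (ℕ.<-≤-trans (0<M a) M≤k) (sum-𝟙-≢ a)))
        (sym (*-identityˡ _))
        where
        open Equivalence
        b≢a : toℕ b ≢ toℕ a
        b≢a b≡a with ≡.refl ← toℕ-injective b≡a = f≁g (holds-~ {D} f-held g-held)

  -- Inclusion probabilities along the stream

  𝔼-step : ∀ k e s (G : State → Carrier) →
    𝔼 (step k e s) G ≈ 𝔼 (sample k e (buffer s)) (λ D → G ⟨ D , updateCount (suc k) e s ⟩)
  𝔼-step k e s = 𝔼->>= (sample k e (buffer s)) _

  all-step : ∀ {ℓ} {P : State → Set ℓ} k e s →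
    (∀ i → P ⟨ overwrite (buffer s) e i , updateCount (suc k) e s ⟩) →
    AllOutcomes P (step k e s)
  all-step {P = P} k e s all =
    AllOutcomes-bind {P = λ D → P ⟨ D , updateCount (suc k) e s ⟩} (λ Px → Px)
      (sample k e (buffer s)) (all-sample k e (buffer s) all)

  run-valid : ∀ k (k≤N : k ℕ.≤ N) → AllOutcomes (Valid k ∘ buffer) (run S k k≤N)
  run-valid zero    _   = valid-initial
  run-valid (suc k) k<N = AllOutcomes-bind
    (λ {s} valid → all-step k _ s (Arrival.valid-overwrite (fromℕ< k<N) (toℕ-fromℕ< k<N) valid))
    (run S k (ℕ.<⇒≤ k<N)) (run-valid k (ℕ.<⇒≤ k<N))

  -- Stream positions lie in `Fin N` and slots in `Fin M`, so the two are compared through `toℕ`. At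
  -- k = M this makes every earlier edge present, which is the base case of both probability
  -- inductions.
  Filled : ℕ → Buffer → Set v
  Filled k D = ∀ i a → toℕ a ≡ toℕ i → toℕ i ℕ.< k → Holds D a (edge i)

  run-filled : ∀ k (k≤N : k ℕ.≤ N) → k ℕ.≤ M → AllOutcomes (Filled k ∘ buffer) (run S k k≤N)
  run-filled zero    _   _   = λ _ _ _ ()
  run-filled (suc k) k<N k<M = AllOutcomes-bind
    (λ {s} filled → ≡.subst
      (λ p → AllOutcomes (Filled (suc k) ∘ buffer) (p >>= λ D → return ⟨ D , updateCount (suc k) (edge j) s ⟩))
      (≡.sym (sample-fill (edge j) (buffer s) k<M)) (filled-overwrite filled))
    (run S k (ℕ.<⇒≤ k<N)) (run-filled k (ℕ.<⇒≤ k<N) (ℕ.<⇒≤ k<M))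
    where
    j = fromℕ< k<N
    filled-overwrite : ∀ {D} → Filled k D → Filled (suc k) (overwrite D (edge j) k)
    filled-overwrite filled i a a≡i i<1+k with toℕ i ℕ.≟ k
    ... | no  i≢k = overwrite-holds′ a (i≢k ∘ ≡.trans (≡.sym a≡i))
                      (filled i a a≡i (ℕ.≤∧≢⇒< (ℕ.s≤s⁻¹ i<1+k) i≢k))
    ... | yes i≡k with ≡.refl ← toℕ-injective (≡.trans i≡k (≡.sym (toℕ-fromℕ< k<N))) =
      overwrite-holds a (≡.trans a≡i i≡k) (inj₁ ≡.refl)

  filled-∈ : ∀ {k D f i} → k ℕ.≤ M → Filled k D → f ~ edge i → toℕ i ℕ.< k → f ∈ D
  filled-∈ {k} {D} {f} {i} k≤M filled f~i i<k = Holds⇒∈ {D = D} (hold (filled i a (toℕ-fromℕ< i<M) i<k))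
    where
    i<M = ℕ.<-≤-trans i<k k≤M
    a = fromℕ< i<M
    hold : Holds D a (edge i) → Holds D a f
    hold = Maybe.map (~-trans f~i)

  -- The tower rule in the form needed: F after the step has, given any valid buffer, conditional
  -- mean x times G before the step. F and G may differ, which permits the passage from a pair to a
  -- single edge or to a constant.
  𝔼-run-suc : ∀ k (k<N : k ℕ.< N) {F : Buffer → Carrier} {G : Buffer → Carrier} {x} →
    (∀ {D} → Valid k D → 𝔼 (sample k (edge (fromℕ< k<N)) D) F ≈ G D * x) →
    𝔼 (run S (suc k) k<N) (F ∘ buffer) ≈ 𝔼 (run S k (ℕ.<⇒≤ k<N)) (G ∘ buffer) * x
  𝔼-run-suc k k<N {F} {G} {x} transition = begin-equality
    𝔼 (run S (suc k) k<N) (F ∘ buffer)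
      ≈⟨ 𝔼->>= p _ (F ∘ buffer) ⟩
    𝔼 p (λ s → 𝔼 (step k (edge (fromℕ< k<N)) s) (F ∘ buffer))
      ≈⟨ 𝔼-cong p (AllOutcomes-map
           (λ {s} valid → trans (𝔼-step k _ s (F ∘ buffer)) (transition valid)) p (run-valid k _)) ⟩
    𝔼 p (λ s → G (buffer s) * x)
      ≈⟨ 𝔼-*ʳ p x (G ∘ buffer) ⟩
    𝔼 p (G ∘ buffer) * x ∎
    where p = run S k (ℕ.<⇒≤ k<N)

  older : ∀ {k} (k<N : k ℕ.< N) {f i} → f ~ edge i → toℕ i ℕ.< k → ¬ (f ~ edge (fromℕ< k<N))
  older k<N f~i i<k f~k = ℕ.<⇒≢ i<k
    (≡.trans (≡.cong toℕ (edge-injective f~i f~k)) (toℕ-fromℕ< k<N))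

  newest : ∀ {k} (k<N : k ℕ.< N) {f i} → f ~ edge i → toℕ i ≡ k → f ~ edge (fromℕ< k<N)
  newest k<N f~i i≡k with ≡.refl ← toℕ-injective (≡.trans i≡k (≡.sym (toℕ-fromℕ< k<N))) = f~i

  𝔼-∈ : ∀ k (k≤N : k ℕ.≤ N) → M ℕ.≤ k → ∀ {f i} → f ~ edge i → toℕ i ℕ.< k →
        𝔼 (run S k k≤N) (λ s → 𝟙 (f ∈? buffer s)) * fromℕ k ≈ fromℕ M
  𝔼-∈ k k≤N M≤k {f} f~i i<k with ℕ.m≤n⇒m<n∨m≡n M≤k
  ... | inj₂ M≡k = begin-equality
    𝔼 p (λ s → 𝟙 (f ∈? buffer s)) * fromℕ k
      ≈⟨ *-congʳ (𝔼-cong p (AllOutcomes-map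
           (λ {s} filled → 𝟙-true (filled-∈ k≤M filled f~i i<k) (f ∈? buffer s))
           p (run-filled k k≤N k≤M))) ⟩
    𝔼 p (λ _ → 1#) * fromℕ k ≈⟨ *-congʳ (𝔼-const p 1#) ⟩
    1# * fromℕ k             ≈⟨ *-identityˡ (fromℕ k) ⟩
    fromℕ k                  ≡⟨ ≡.cong fromℕ M≡k ⟨
    fromℕ M                  ∎
    where
    p = run S k k≤N
    k≤M = ℕ.≤-reflexive (≡.sym M≡k)
  𝔼-∈ (suc k) k<N M≤k {f} f~i i<1+k | inj₁ (s≤s M≤k′) with ℕ.m≤n⇒m<n∨m≡n (ℕ.s≤s⁻¹ i<1+k)
  ... | inj₁ i<k = begin-equality
    𝔼 (run S (suc k) k<N) (λ s → 𝟙 (f ∈? buffer s)) * fromℕ (suc k)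
      ≈⟨ *-congʳ (𝔼-run-suc k k<N λ valid →
           Arrival.𝔼-sample-old _ (toℕ-fromℕ< k<N) valid M≤k′ (older k<N f~i i<k)) ⟩
    E * (fromℕ k * fromℕ (suc k) ⁻¹) * fromℕ (suc k)
      ≈⟨ solve 4 (λ e k s t → e :* (k :* t) :* s := e :* k :* (s :* t)) refl E (fromℕ k) (fromℕ (suc k)) (fromℕ (suc k) ⁻¹) ⟩
    E * fromℕ k * (fromℕ (suc k) * fromℕ (suc k) ⁻¹)
      ≈⟨ *-cong (𝔼-∈ k _ M≤k′ f~i i<k) (fromℕ-inverseʳ k) ⟩
    fromℕ M * 1#
      ≈⟨ *-identityʳ (fromℕ M) ⟩
    fromℕ M ∎
    where E = 𝔼 (run S k (ℕ.<⇒≤ k<N)) (λ s → 𝟙 (f ∈? buffer s))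
  ... | inj₂ i≡k = begin-equality
    𝔼 (run S (suc k) k<N) (λ s → 𝟙 (f ∈? buffer s)) * fromℕ (suc k)
      ≈⟨ *-congʳ (𝔼-run-suc k k<N λ valid → trans
           (Arrival.𝔼-sample-new _ (toℕ-fromℕ< k<N) valid M≤k′ (newest k<N f~i i≡k))
           (sym (*-identityˡ _))) ⟩
    𝔼 p (λ _ → 1#) * (fromℕ M * fromℕ (suc k) ⁻¹) * fromℕ (suc k)
      ≈⟨ *-congʳ (*-congʳ (𝔼-const p 1#)) ⟩
    1# * (fromℕ M * fromℕ (suc k) ⁻¹) * fromℕ (suc k)
      ≈⟨ solve 4 (λ e m s t → e :* (m :* t) :* s := e :* (m :* (s :* t))) refl 1# (fromℕ M) (fromℕ (suc k)) (fromℕ (suc k) ⁻¹) ⟩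
    1# * (fromℕ M * (fromℕ (suc k) * fromℕ (suc k) ⁻¹))
      ≈⟨ trans (*-identityˡ _) (*-congˡ (fromℕ-inverseʳ k)) ⟩
    fromℕ M * 1#
      ≈⟨ *-identityʳ (fromℕ M) ⟩
    fromℕ M ∎
    where p = run S k (ℕ.<⇒≤ k<N)

  private
    -- Cancels the factor k + 1 and groups e with k: for a single-edge probability e, the product e
    -- k is evaluated by `𝔼-∈`; for a pair and c = k - 1, the result is the induction hypothesis.
    scale-suc : ∀ k e c → e * (c * fromℕ (suc k) ⁻¹) * fromℕ (suc k ℕ.* k) ≈ e * fromℕ k * c
    scale-suc k e c = begin-equality
      e * (c * fromℕ (suc k) ⁻¹) * fromℕ (suc k ℕ.* k)
        ≈⟨ *-congˡ (fromℕ-homo-* (suc k) k) ⟩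
      e * (c * fromℕ (suc k) ⁻¹) * (fromℕ (suc k) * fromℕ k)
        ≈⟨ solve 5 (λ e c k s t → e :* (c :* t) :* (s :* k) := e :* k :* c :* (s :* t)) refl
             e c (fromℕ k) (fromℕ (suc k)) (fromℕ (suc k) ⁻¹) ⟩
      e * fromℕ k * c * (fromℕ (suc k) * fromℕ (suc k) ⁻¹)
        ≈⟨ *-congˡ (fromℕ-inverseʳ k) ⟩
      e * fromℕ k * c * 1#
        ≈⟨ *-identityʳ _ ⟩
      e * fromℕ k * c ∎

  -- Two old edges both survive with probability (k-1)/(k+1), which preserves the product. If one
  -- edge is the newest, the probability is M/k for the other times (M-1)/(k+1). Both cannot be
  -- newest, since they differ.
  𝔼-∈-∈ : ∀ k (k≤N : k ℕ.≤ N) → M ℕ.≤ k → ∀ {f g i j} → ¬ (f ~ g) →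
          f ~ edge i → toℕ i ℕ.< k → g ~ edge j → toℕ j ℕ.< k →
          𝔼 (run S k k≤N) (λ s → 𝟙 ((f ∈? buffer s) ×-dec (g ∈? buffer s))) * fromℕ (k ℕ.* (k ∸ 1))
          ≈ fromℕ (M ℕ.* (M ∸ 1))
  𝔼-∈-∈ k k≤N M≤k {f} {g} f≁g f~i i<k g~j j<k with ℕ.m≤n⇒m<n∨m≡n M≤k
  ... | inj₂ M≡k = begin-equality
    𝔼 p (λ s → 𝟙 ((f ∈? buffer s) ×-dec (g ∈? buffer s))) * fromℕ (k ℕ.* (k ∸ 1))
      ≈⟨ *-congʳ (𝔼-cong p (AllOutcomes-map
           (λ {s} filled → 𝟙-true (filled-∈ k≤M filled f~i i<k , filled-∈ k≤M filled g~j j<k)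
                                  ((f ∈? buffer s) ×-dec (g ∈? buffer s)))
           p (run-filled k k≤N k≤M))) ⟩
    𝔼 p (λ _ → 1#) * fromℕ (k ℕ.* (k ∸ 1)) ≈⟨ *-congʳ (𝔼-const p 1#) ⟩
    1# * fromℕ (k ℕ.* (k ∸ 1))             ≈⟨ *-identityˡ _ ⟩
    fromℕ (k ℕ.* (k ∸ 1))                  ≡⟨ ≡.cong (λ m → fromℕ (m ℕ.* (m ∸ 1))) M≡k ⟨
    fromℕ (M ℕ.* (M ∸ 1))                  ∎
    where
    p = run S k k≤N
    k≤M = ℕ.≤-reflexive (≡.sym M≡k)
  𝔼-∈-∈ (suc k) k<N M≤k {f} {g} f≁g f~i i<1+k g~j j<1+k | inj₁ (s≤s M≤k′)
    with ℕ.m≤n⇒m<n∨m≡n (ℕ.s≤s⁻¹ i<1+k) | ℕ.m≤n⇒m<n∨m≡n (ℕ.s≤s⁻¹ j<1+k)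
  ... | inj₂ i≡k | inj₂ j≡k =
    contradiction (~-trans (newest k<N f~i i≡k) (~-sym (newest k<N g~j j≡k))) f≁g
  ... | inj₁ i<k | inj₁ j<k = begin-equality
    𝔼 (run S (suc k) k<N) (λ s → 𝟙 ((f ∈? buffer s) ×-dec (g ∈? buffer s))) * fromℕ (suc k ℕ.* k)
      ≈⟨ *-congʳ (𝔼-run-suc k k<N λ valid → Arrival.𝔼-sample-old-old _ (toℕ-fromℕ< k<N) valid M≤k′
           f≁g (older k<N f~i i<k) (older k<N g~j j<k)) ⟩
    E * (fromℕ (k ∸ 1) * fromℕ (suc k) ⁻¹) * fromℕ (suc k ℕ.* k)
      ≈⟨ scale-suc k E (fromℕ (k ∸ 1)) ⟩
    E * fromℕ k * fromℕ (k ∸ 1)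
      ≈⟨ trans (*-assoc _ _ _) (*-congˡ (sym (fromℕ-homo-* k (k ∸ 1)))) ⟩
    E * fromℕ (k ℕ.* (k ∸ 1))
      ≈⟨ 𝔼-∈-∈ k _ M≤k′ f≁g f~i i<k g~j j<k ⟩
    fromℕ (M ℕ.* (M ∸ 1)) ∎
    where E = 𝔼 (run S k (ℕ.<⇒≤ k<N)) (λ s → 𝟙 ((f ∈? buffer s) ×-dec (g ∈? buffer s)))
  ... | inj₁ i<k | inj₂ j≡k = begin-equality
    𝔼 (run S (suc k) k<N) (λ s → 𝟙 ((f ∈? buffer s) ×-dec (g ∈? buffer s))) * fromℕ (suc k ℕ.* k)
      ≈⟨ *-congʳ (𝔼-run-suc k k<N λ valid → Arrival.𝔼-sample-old-new _ (toℕ-fromℕ< k<N) valid M≤k′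
           (older k<N f~i i<k) (newest k<N g~j j≡k)) ⟩
    E * (fromℕ (M ∸ 1) * fromℕ (suc k) ⁻¹) * fromℕ (suc k ℕ.* k)
      ≈⟨ scale-suc k E (fromℕ (M ∸ 1)) ⟩
    E * fromℕ k * fromℕ (M ∸ 1)
      ≈⟨ *-congʳ (𝔼-∈ k _ M≤k′ f~i i<k) ⟩
    fromℕ M * fromℕ (M ∸ 1)
      ≈⟨ fromℕ-homo-* M (M ∸ 1) ⟨
    fromℕ (M ℕ.* (M ∸ 1)) ∎
    where E = 𝔼 (run S k (ℕ.<⇒≤ k<N)) (λ s → 𝟙 (f ∈? buffer s))
  ... | inj₂ i≡k | inj₁ j<k = begin-equality
    𝔼 (run S (suc k) k<N) (λ s → 𝟙 ((f ∈? buffer s) ×-dec (g ∈? buffer s))) * fromℕ (suc k ℕ.* k)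
      ≈⟨ *-congʳ (𝔼-cong′ (run S (suc k) k<N) λ s → 𝟙-⇔ (mk⇔ swap swap)
           ((f ∈? buffer s) ×-dec (g ∈? buffer s)) ((g ∈? buffer s) ×-dec (f ∈? buffer s))) ⟩
    𝔼 (run S (suc k) k<N) (λ s → 𝟙 ((g ∈? buffer s) ×-dec (f ∈? buffer s))) * fromℕ (suc k ℕ.* k)
      ≈⟨ *-congʳ (𝔼-run-suc k k<N λ valid → Arrival.𝔼-sample-old-new _ (toℕ-fromℕ< k<N) valid M≤k′
           (older k<N g~j j<k) (newest k<N f~i i≡k)) ⟩
    E * (fromℕ (M ∸ 1) * fromℕ (suc k) ⁻¹) * fromℕ (suc k ℕ.* k)
      ≈⟨ scale-suc k E (fromℕ (M ∸ 1)) ⟩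
    E * fromℕ k * fromℕ (M ∸ 1)
      ≈⟨ *-congʳ (𝔼-∈ k _ M≤k′ g~j j<k) ⟩
    fromℕ M * fromℕ (M ∸ 1)
      ≈⟨ fromℕ-homo-* M (M ∸ 1) ⟨
    fromℕ (M ℕ.* (M ∸ 1)) ∎
    where E = 𝔼 (run S k (ℕ.<⇒≤ k<N)) (λ s → 𝟙 (g ∈? buffer s))

-- Distinctness of triangle edges, and an inequality of natural numbers

module _ {v} {V : Set v} (Δ : Triangle V) where
  open Triangle Δ

  xy≁yz : ¬ (xy ~ yz)
  xy≁yz (inj₁ eq) = x≢y (≡.cong proj₁ eq)
  xy≁yz (inj₂ eq) = x≢z (≡.cong proj₁ eq)

  xy≁xz : ¬ (xy ~ xz)
  xy≁xz (inj₁ eq) = y≢z (≡.cong proj₂ eq)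
  xy≁xz (inj₂ eq) = x≢z (≡.cong proj₁ eq)

  yz≁xz : ¬ (yz ~ xz)
  yz≁xz (inj₁ eq) = x≢y (≡.sym (≡.cong proj₁ eq))
  yz≁xz (inj₂ eq) = y≢z (≡.cong proj₁ eq)

0<m[m∸1] : ∀ {m} → 2 ℕ.≤ m → 0 ℕ.< m ℕ.* (m ∸ 1)
0<m[m∸1] 2≤m = ℕ.*-mono-≤ (ℕ.<⇒≤ 2≤m) (ℕ.∸-monoˡ-≤ 1 2≤m)

-- If n ≤ 2m, then n is subtracted from the larger side and 2m from the smaller one, which keeps the
-- order. If 2m ≤ n, the hypothesis on squares gives way to a comparison of factors: 2m ≤ n and m -
-- 1 ≤ n - 1.
2m²≤n²⇒2m[m∸1]≤n[n∸1] : ∀ m n → 2 ℕ.* (m ℕ.* m) ℕ.≤ n ℕ.* n →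
                        2 ℕ.* (m ℕ.* (m ∸ 1)) ℕ.≤ n ℕ.* (n ∸ 1)
2m²≤n²⇒2m[m∸1]≤n[n∸1] m n 2m²≤n² with ℕ.≤-total n (2 ℕ.* m)
... | inj₁ n≤2m = begin
  2 ℕ.* (m ℕ.* (m ∸ 1))                ≡⟨ ≡.cong (2 ℕ.*_) (ℕ.*-distribˡ-∸ m m 1) ⟩
  2 ℕ.* (m ℕ.* m ∸ m ℕ.* 1)            ≡⟨ ℕ.*-distribˡ-∸ 2 (m ℕ.* m) (m ℕ.* 1) ⟩
  2 ℕ.* (m ℕ.* m) ∸ 2 ℕ.* (m ℕ.* 1)    ≤⟨ ℕ.∸-mono 2m²≤n² n≤2m′ ⟩
  n ℕ.* n ∸ n ℕ.* 1                    ≡⟨ ℕ.*-distribˡ-∸ n n 1 ⟨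
  n ℕ.* (n ∸ 1)                        ∎
  where
  open ℕ.≤-Reasoning
  n≤2m′ : n ℕ.* 1 ℕ.≤ 2 ℕ.* (m ℕ.* 1)
  n≤2m′ = begin
    n ℕ.* 1         ≡⟨ ℕ.*-identityʳ n ⟩
    n               ≤⟨ n≤2m ⟩
    2 ℕ.* m         ≡⟨ ≡.cong (2 ℕ.*_) (ℕ.*-identityʳ m) ⟨
    2 ℕ.* (m ℕ.* 1) ∎
... | inj₂ 2m≤n = begin
  2 ℕ.* (m ℕ.* (m ∸ 1)) ≡⟨ ℕ.*-assoc 2 m (m ∸ 1) ⟨
  2 ℕ.* m ℕ.* (m ∸ 1)   ≤⟨ ℕ.*-mono-≤ 2m≤n (ℕ.∸-monoˡ-≤ 1 (ℕ.≤-trans (ℕ.m≤m+n m _) 2m≤n)) ⟩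
  n ℕ.* (n ∸ 1)         ∎
  where open ℕ.≤-Reasoning

-- The law of the FURL-S count of one triangle

module TriangleCount {c ℓ₁ ℓ₂ v} (K : OrderedField c ℓ₁ ℓ₂) {V : Set v} (_≟_ : DecidableEquality V)
                     (M : ℕ) {N : ℕ} (S : SimpleStream V N) (Δ : Triangle V) where
  open OrderedField K hiding (zero)
  open OrderedFieldProperties K
  open Expectation K
  open ExpectationProperties K
  open FURL-S K _≟_ M
  open SimpleStream S
  open Reservoir K _≟_ M S
  open Triangle Δ
  open <-Reasoning

  -- This and `consistsOf-closed` are weak consequences of being counted. That all three edges are
  -- arriving or held excludes times before the closing one; that some edge is arriving excludes
  -- later times.
  consistsOf-covered : ∀ {e D} → ConsistsOf Δ e D → All (λ f → f ~ e ⊎ f ∈ D) edges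
  consistsOf-covered (inj₁ (xy~e , yz∈D , xz∈D))        = inj₁ xy~e ∷ inj₂ yz∈D ∷ inj₂ xz∈D ∷ []
  consistsOf-covered (inj₂ (inj₁ (yz~e , xy∈D , xz∈D))) = inj₂ xy∈D ∷ inj₁ yz~e ∷ inj₂ xz∈D ∷ []
  consistsOf-covered (inj₂ (inj₂ (xz~e , xy∈D , yz∈D))) = inj₂ xy∈D ∷ inj₂ yz∈D ∷ inj₁ xz~e ∷ []

  consistsOf-closed : ∀ {e D} → ConsistsOf Δ e D → Any (_~ e) edges
  consistsOf-closed (inj₁ (xy~e , _))        = here xy~e
  consistsOf-closed (inj₂ (inj₁ (yz~e , _))) = there (here yz~e)
  consistsOf-closed (inj₂ (inj₂ (xz~e , _))) = there (there (here xz~e))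

  -- Hides which of the three edges comes last: f and g are the other two, and counting at time n +
  -- 1 means that both are in the buffer.
  record ClosedBy {n} (n<N : n ℕ.< N) : Set v where
    field
      arrived : All (λ f → Σ (Fin N) λ i → toℕ i ℕ.≤ n × f ~ edge i) edges
      last    : Any (_~ edge (fromℕ< n<N)) edges
      {f g}   : Edge V
      {i j}   : Fin N
      f≁g     : ¬ (f ~ g)
      f~i     : f ~ edge i
      i<n     : toℕ i ℕ.< n
      g~j     : g ~ edge j
      j<n     : toℕ j ℕ.< n
      consistsOf⇔ : ∀ {D} → Valid n D → ConsistsOf Δ (edge (fromℕ< n<N)) D ⇔ (f ∈ D × g ∈ D)

  formed⇒closed : ∀ {n} (n<N : n ℕ.< N) → FormedAt S Δ (suc n) → ClosedBy n<N
  formed⇒closed {n} n<N ((i₁ , i₁< , xy~) ∷ (i₂ , i₂< , yz~) ∷ (i₃ , i₃< , xz~) ∷ [] , at-n) = close at-n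
    where
    present : All (λ f → Σ (Fin N) λ i → toℕ i ℕ.≤ n × f ~ edge i) edges
    present = (i₁ , ℕ.s≤s⁻¹ i₁< , xy~) ∷ (i₂ , ℕ.s≤s⁻¹ i₂< , yz~) ∷ (i₃ , ℕ.s≤s⁻¹ i₃< , xz~) ∷ []

    earlier : ∀ {l f i} → l ~ edge (fromℕ< n<N) → ¬ (l ~ f) → f ~ edge i → toℕ i ℕ.< suc n → toℕ i ℕ.< n
    earlier l~n l≁f f~i i<1+n = ℕ.≤∧≢⇒< (ℕ.s≤s⁻¹ i<1+n)
      λ i≡n → l≁f (~-trans l~n (~-sym (newest n<N f~i i≡n)))

    -- The closing edge cannot be in the buffer yet, which refutes the two disjuncts of `ConsistsOf`
    -- in which another edge would be arriving.
    absent : ∀ {l D} → l ~ edge (fromℕ< n<N) → Valid n D → ¬ (l ∈ D)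
    absent l~n valid l∈D = Valid.∈-arrived valid l∈D (ℕ.≤-reflexive (≡.sym (toℕ-fromℕ< n<N))) l~n

    close : Any (λ f → Σ (Fin N) λ k → suc (toℕ k) ≡ suc n × f ~ edge k) edges → ClosedBy n<N
    close (here (k , k≡ , xy~k)) = record
      { arrived = present ; last = here xy~n
      ; f≁g = yz≁xz Δ
      ; f~i = yz~ ; i<n = earlier xy~n (xy≁yz Δ) yz~ i₂<
      ; g~j = xz~ ; j<n = earlier xy~n (xy≁xz Δ) xz~ i₃<
      ; consistsOf⇔ = λ {D} valid → mk⇔
          (λ { (inj₁ (_ , yz∈D , xz∈D))     → yz∈D , xz∈D
             ; (inj₂ (inj₁ (_ , xy∈D , _))) → contradiction xy∈D (absent xy~n valid)
             ; (inj₂ (inj₂ (_ , xy∈D , _))) → contradiction xy∈D (absent xy~n valid) })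
          (λ both → inj₁ (xy~n , both)) }
      where xy~n = newest n<N xy~k (ℕ.suc-injective k≡)
    close (there (here (k , k≡ , yz~k))) = record
      { arrived = present ; last = there (here yz~n)
      ; f≁g = xy≁xz Δ
      ; f~i = xy~ ; i<n = earlier yz~n (xy≁yz Δ ∘ ~-sym) xy~ i₁<
      ; g~j = xz~ ; j<n = earlier yz~n (yz≁xz Δ) xz~ i₃<
      ; consistsOf⇔ = λ {D} valid → mk⇔
          (λ { (inj₁ (_ , yz∈D , _))           → contradiction yz∈D (absent yz~n valid)
             ; (inj₂ (inj₁ (_ , xy∈D , xz∈D))) → xy∈D , xz∈D
             ; (inj₂ (inj₂ (_ , _ , yz∈D)))    → contradiction yz∈D (absent yz~n valid) })
          (λ both → inj₂ (inj₁ (yz~n , both))) }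
      where yz~n = newest n<N yz~k (ℕ.suc-injective k≡)
    close (there (there (here (k , k≡ , xz~k)))) = record
      { arrived = present ; last = there (there (here xz~n))
      ; f≁g = xy≁yz Δ
      ; f~i = xy~ ; i<n = earlier xz~n (xy≁xz Δ ∘ ~-sym) xy~ i₁<
      ; g~j = yz~ ; j<n = earlier xz~n (yz≁xz Δ ∘ ~-sym) yz~ i₂<
      ; consistsOf⇔ = λ {D} valid → mk⇔
          (λ { (inj₁ (_ , _ , xz∈D))           → contradiction xz∈D (absent xz~n valid)
             ; (inj₂ (inj₁ (_ , _ , xz∈D)))    → contradiction xz∈D (absent xz~n valid)
             ; (inj₂ (inj₂ (_ , xy∈D , yz∈D))) → xy∈D , yz∈D })
          (λ both → inj₂ (inj₂ (xz~n , both))) }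
      where xz~n = newest n<N xz~k (ℕ.suc-injective k≡)

  updateCount-miss : ∀ T e s → ¬ ConsistsOf Δ e (buffer s) → updateCount T e s Δ ≡ count s Δ
  updateCount-miss T e s miss =
    ≡.cong (if_then weight T else count s Δ) (dec-false (consistsOf? Δ e (buffer s)) miss)

  module _ {n} (n<N : n ℕ.< N) (closed : ClosedBy n<N) where
    open ClosedBy closed

    miss-before : ∀ {k D} (k<N : k ℕ.< N) → k ℕ.< n → Valid k D →
                  ¬ ConsistsOf Δ (edge (fromℕ< k<N)) D
    miss-before {k} k<N k<n valid consists with All.lookupAny (consistsOf-covered consists) last
    ... | inj₁ l~k , l~n = ℕ.<⇒≢ k<n (≡.trans (≡.sym (toℕ-fromℕ< k<N))
      (≡.trans (≡.cong toℕ (edge-injective l~k l~n)) (toℕ-fromℕ< n<N)))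
    ... | inj₂ l∈D , l~n = Valid.∈-arrived valid l∈D
      (ℕ.≤-trans (ℕ.<⇒≤ k<n) (ℕ.≤-reflexive (≡.sym (toℕ-fromℕ< n<N)))) l~n

    miss-after : ∀ {k D} (k<N : k ℕ.< N) → n ℕ.< k → ¬ ConsistsOf Δ (edge (fromℕ< k<N)) D
    miss-after {k} {D} k<N n<k consists
      with (i , i≤n , f~i) , f~k ← All.lookupAny arrived (consistsOf-closed {D = D} consists) =
      older k<N f~i (ℕ.≤-<-trans i≤n n<k) f~k

    run-uncounted : ∀ k (k≤N : k ℕ.≤ N) → k ℕ.≤ n →
                    AllOutcomes (λ s → count s Δ ≡ 0#) (run S k k≤N)
    run-uncounted zero    _   _   = ≡.refl
    run-uncounted (suc k) k<N k<n = AllOutcomes-bind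
      (λ {s} (valid , uncounted) → all-step k _ s λ _ →
        ≡.trans (updateCount-miss (suc k) _ s (miss-before k<N k<n valid)) uncounted)
      p (AllOutcomes-zip p (run-valid k (ℕ.<⇒≤ k<N)) (run-uncounted k (ℕ.<⇒≤ k<N) (ℕ.<⇒≤ k<n)))
      where p = run S k (ℕ.<⇒≤ k<N)

    private
      both? : ∀ D → Dec (f ∈ D × g ∈ D)
      both? D = (f ∈? D) ×-dec (g ∈? D)

      p₀ : Prob State
      p₀ = run S n (ℕ.<⇒≤ n<N)

    hit miss : Carrier
    hit  = 𝔼 p₀ (λ s → 𝟙 (both? (buffer s)))
    miss = 𝔼 p₀ (λ s → 𝟙 (¬? (both? (buffer s))))

    hit+miss≈1 : hit + miss ≈ 1#
    hit+miss≈1 = begin-equality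
      hit + miss                                                    ≈⟨ 𝔼-+ p₀ _ _ ⟨
      𝔼 p₀ (λ s → 𝟙 (both? (buffer s)) + 𝟙 (¬? (both? (buffer s)))) ≈⟨ 𝔼-cong′ p₀ (λ s → 𝟙-complement (both? (buffer s))) ⟩
      𝔼 p₀ (λ _ → 1#)                                               ≈⟨ 𝔼-const p₀ 1# ⟩
      1#                                                            ∎

    hit-probability : M ℕ.≤ n → hit * fromℕ (n ℕ.* (n ∸ 1)) ≈ fromℕ (M ℕ.* (M ∸ 1))
    hit-probability M≤n = 𝔼-∈-∈ n _ M≤n f≁g f~i i<n g~j j<n

    -- A function h is carried along so that mean and variance are two instances of one law. It is
    -- not assumed to respect `≈`; hence counts and weights are rewritten under h by propositional
    -- equality only.
    law-at-closing : ∀ (h : Carrier → Carrier) →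
      𝔼 (run S (suc n) n<N) (λ s → h (count s Δ)) ≈ hit * h (weight (suc n)) + miss * h 0#
    law-at-closing h = begin-equality
      𝔼 (run S (suc n) n<N) (λ s → h (count s Δ))
        ≈⟨ 𝔼->>= p₀ _ _ ⟩
      𝔼 p₀ (λ s → 𝔼 (step n (edge (fromℕ< n<N)) s) (λ s → h (count s Δ)))
        ≈⟨ 𝔼-cong p₀ (AllOutcomes-map (λ {s} (valid , uncounted) → outcome s valid uncounted) p₀
             (AllOutcomes-zip p₀ (run-valid n _) (run-uncounted n _ ℕ.≤-refl))) ⟩
      𝔼 p₀ (λ s → 𝟙 (both? (buffer s)) * h w + 𝟙 (¬? (both? (buffer s))) * h 0#)
        ≈⟨ 𝔼-+ p₀ _ _ ⟩
      𝔼 p₀ (λ s → 𝟙 (both? (buffer s)) * h w) + 𝔼 p₀ (λ s → 𝟙 (¬? (both? (buffer s))) * h 0#)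
        ≈⟨ +-cong (𝔼-*ʳ p₀ (h w) _) (𝔼-*ʳ p₀ (h 0#) _) ⟩
      hit * h w + miss * h 0# ∎
      where
      w = weight (suc n)

      branches : ∀ {ℓ} {A : Set ℓ} (A? : Dec A) →
                 h (if does A? then w else 0#) ≈ 𝟙 A? * h w + 𝟙 (¬? A?) * h 0#
      branches (yes _) = sym (trans (+-cong (*-identityˡ (h w)) (zeroˡ (h 0#))) (+-identityʳ (h w)))
      branches (no _)  = sym (trans (+-cong (zeroˡ (h w)) (*-identityˡ (h 0#))) (+-identityˡ (h 0#)))

      outcome : ∀ s → Valid n (buffer s) → count s Δ ≡ 0# →
        𝔼 (step n (edge (fromℕ< n<N)) s) (λ s → h (count s Δ)) ≈
        𝟙 (both? (buffer s)) * h w + 𝟙 (¬? (both? (buffer s))) * h 0#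
      outcome s valid uncounted = begin-equality
        𝔼 (step n (edge (fromℕ< n<N)) s) (λ s → h (count s Δ))
          ≈⟨ trans (𝔼-step n _ s _) (𝔼-const (sample n (edge (fromℕ< n<N)) (buffer s)) _) ⟩
        h (updateCount (suc n) (edge (fromℕ< n<N)) s Δ)
          ≡⟨ ≡.cong₂ (λ b x → h (if b then w else x))
               (does-⇔ (consistsOf⇔ valid) (consistsOf? Δ _ (buffer s)) (both? (buffer s))) uncounted ⟩
        h (if does (both? (buffer s)) then w else 0#)
          ≈⟨ branches (both? (buffer s)) ⟩
        𝟙 (both? (buffer s)) * h w + 𝟙 (¬? (both? (buffer s))) * h 0# ∎

    law : ∀ T (T≤N : T ℕ.≤ N) → n ℕ.< T → ∀ (h : Carrier → Carrier) →
          𝔼 (run S T T≤N) (λ s → h (count s Δ)) ≈ hit * h (weight (suc n)) + miss * h 0#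
    law (suc k) k<N n<T h with ℕ.m≤n⇒m<n∨m≡n (ℕ.s≤s⁻¹ n<T)
    -- `run` carries a proof of its time bound, and the two proofs at hand have to be identified.
    ... | inj₂ ≡.refl = trans
      (reflexive (≡.cong (λ n<N → 𝔼 (run S (suc n) n<N) (λ s → h (count s Δ))) (ℕ.≤-irrelevant k<N n<N)))
      (law-at-closing h)
    ... | inj₁ n<k = begin-equality
      𝔼 (run S (suc k) k<N) (λ s → h (count s Δ))
        ≈⟨ 𝔼->>= p _ _ ⟩
      𝔼 p (λ s → 𝔼 (step k (edge (fromℕ< k<N)) s) (λ s → h (count s Δ)))
        ≈⟨ 𝔼-cong′ p (λ s → trans (𝔼-step k _ s _)
             (trans (𝔼-const (sample k (edge (fromℕ< k<N)) (buffer s)) _)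
               (reflexive (≡.cong h (updateCount-miss (suc k) _ s (miss-after {D = buffer s} k<N n<k)))))) ⟩
      𝔼 p (λ s → h (count s Δ))
        ≈⟨ law k (ℕ.<⇒≤ k<N) n<k h ⟩
      hit * h (weight (suc n)) + miss * h 0# ∎
      where p = run S k (ℕ.<⇒≤ k<N)

    module _ (2≤M : 2 ℕ.≤ M) (M+1≤n : M ℕ.+ 1 ℕ.≤ n) where
      weight-closing : weight (suc n) ≡ q (suc n)
      weight-closing = ≡.cong (if_then 1# else q (suc n)) (dec-false (suc n ℕ.≤? M ℕ.+ 1) (ℕ.<⇒≱ (s≤s M+1≤n)))

      -- At time n + 1 the numerator of q reduces to n(n-1), matching the probability at index n;
      -- `2 ≤ M` makes M(M-1) invertible, so that the inverse has its meaning.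
      hit*q≈1 : hit * q (suc n) ≈ 1#
      hit*q≈1 = begin-equality
        hit * (fromℕ (n ℕ.* (n ∸ 1)) * fromℕ (M ℕ.* (M ∸ 1)) ⁻¹) ≈⟨ *-assoc _ _ _ ⟨
        hit * fromℕ (n ℕ.* (n ∸ 1)) * fromℕ (M ℕ.* (M ∸ 1)) ⁻¹   ≈⟨ *-congʳ (hit-probability (ℕ.m+n≤o⇒m≤o M M+1≤n)) ⟩
        fromℕ (M ℕ.* (M ∸ 1)) * fromℕ (M ℕ.* (M ∸ 1)) ⁻¹         ≈⟨ ⁻¹-inverseʳ (0<x⇒x≉0 (0<fromℕ (0<m[m∸1] 2≤M))) ⟩
        1#                                                       ∎

      module _ T (T≤N : T ℕ.≤ N) (n<T : n ℕ.< T) where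
        𝔼-count : 𝔼 (run S T T≤N) (λ s → count s Δ) ≈ 1#
        𝔼-count = begin-equality
          𝔼 (run S T T≤N) (λ s → count s Δ)     ≈⟨ law T T≤N n<T (λ x → x) ⟩
          hit * weight (suc n) + miss * 0#      ≈⟨ +-cong (*-congˡ (reflexive weight-closing)) (zeroʳ miss) ⟩
          hit * q (suc n) + 0#                  ≈⟨ +-identityʳ _ ⟩
          hit * q (suc n)                       ≈⟨ hit*q≈1 ⟩
          1#                                    ∎

        Var-count : Var (run S T T≤N) (λ s → count s Δ) ≈ q (suc n) - 1#
        Var-count = begin-equality
          Var (run S T T≤N) (λ s → count s Δ)
            ≈⟨ Var-cong (run S T T≤N) (λ s → count s Δ) 𝔼-count ⟩
          𝔼 (run S T T≤N) (λ s → (count s Δ - 1#) * (count s Δ - 1#))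
            ≈⟨ law T T≤N n<T (λ x → (x - 1#) * (x - 1#)) ⟩
          hit * ((weight (suc n) - 1#) * (weight (suc n) - 1#)) + miss * ((0# - 1#) * (0# - 1#))
            ≡⟨ ≡.cong (λ w → hit * ((w - 1#) * (w - 1#)) + miss * ((0# - 1#) * (0# - 1#))) weight-closing ⟩
          hit * ((q (suc n) - 1#) * (q (suc n) - 1#)) + miss * ((0# - 1#) * (0# - 1#))
            ≈⟨ two-point-variance hit+miss≈1 hit*q≈1 ⟩
          q (suc n) - 1# ∎

-- Exponential decay as multiplication by a constant

module DecayFactor {c ℓ₁ ℓ₂} (K : OrderedField c ℓ₁ ℓ₂) (M J : ℕ) .{{_ : NonZero J}}
                   (δ : OrderedField.Carrier K) where
  open OrderedField K hiding (zero)
  open OrderedFieldProperties K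
  open ExpectationProperties K using (𝟙-false)
  open FURL-SX K M J δ
  open Solver using (solve; _:=_; _:+_; _:*_)
  open <-Reasoning

  module _ (0<δ : 0# < δ) (δ<1 : δ < 1#) {Tλ} (T-M<Tλ : T-M ℕ.< Tλ) where
    private
      0<1-δ : 0# < 1# - δ
      0<1-δ = x<y⇒0<y-x δ<1

      estimate : Carrier → ℕ → Carrier
      estimate X t = if does (Tλ ℕ.≤? t) then X else 0#

    -- The induction hypothesis over buckets. κ is chosen before X, hence it is not random. It may
    -- vanish while the triangle is unformed, so positivity is promised only from Tλ on, whereas the
    -- bounds 0 ≤ κ < 1 pass through every bucket.
    record Factor (i t : ℕ) : Set (c ⊔ ℓ₁ ⊔ ℓ₂) where
      field
        κ     : Carrier
        0≤κ   : 0# ≤ᶠ κ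
        κ<1   : κ < 1#
        0<κ   : 0 ℕ.< i → Tλ ℕ.≤ t → 0# < κ
        scale : ∀ X → decayIn (estimate X) i t ≈ κ * X

    -- `decayIn` at index 0 returns the raw estimate, whose factor would be 1 from Tλ on; the
    -- premise restricts that index to times of bucket 0, all before Tλ, where the factor is 0. Each
    -- later bucket maps κ to δκ or δκ + (1 - δ), and both stay below 1.
    factor : ∀ i t → (i ≡ 0 → t ℕ.≤ T-M) → Factor i t
    factor zero t t≤ = record
      { κ = 0# ; 0≤κ = inj₂ refl ; κ<1 = 0<1 ; 0<κ = λ ()
      ; scale = λ X → trans
          (reflexive (≡.cong (if_then X else 0#) (dec-false (Tλ ℕ.≤? t) (ℕ.<⇒≱ (ℕ.≤-<-trans (t≤ ≡.refl) T-M<Tλ)))))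
          (sym (zeroˡ X)) }
    factor (suc i) t _ = extend (Tλ ℕ.≤? t) ≡.refl
      where
      previous = factor i (T-M ℕ.+ i ℕ.* J) λ { ≡.refl → ℕ.≤-reflexive (ℕ.+-identityʳ T-M) }
      open Factor previous renaming (κ to κ′; 0≤κ to 0≤κ′; κ<1 to κ′<1; scale to scale′) using ()

      0≤δκ′ : 0# ≤ᶠ δ * κ′
      0≤δκ′ = begin
        0#     ≈⟨ zeroʳ δ ⟨
        δ * 0# ≤⟨ *-monoʳ-≤ (inj₁ 0<δ) 0≤κ′ ⟩
        δ * κ′ ∎

      δκ′<δ : δ * κ′ < δ
      δκ′<δ = begin-strict
        δ * κ′ <⟨ *-monoʳ-< 0<δ κ′<1 ⟩
        δ * 1# ≈⟨ *-identityʳ δ ⟩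
        δ      ∎

      0<δκ′+1-δ : 0# < δ * κ′ + (1# - δ)
      0<δκ′+1-δ = begin-strict
        0#                 ≤⟨ 0≤δκ′ ⟩
        δ * κ′             ≈⟨ +-identityʳ (δ * κ′) ⟨
        δ * κ′ + 0#        <⟨ +-monoʳ-< (δ * κ′) 0<1-δ ⟩
        δ * κ′ + (1# - δ)  ∎

      extend : (Tλ≤?t : Dec (Tλ ℕ.≤ t)) → (Tλ ℕ.≤? t) ≡ Tλ≤?t → Factor (suc i) t
      extend (yes Tλ≤t) eq = record
        { κ   = δ * κ′ + (1# - δ)
        ; 0≤κ = inj₁ 0<δκ′+1-δ
        ; κ<1 = begin-strict
            δ * κ′ + (1# - δ) <⟨ +-monoˡ-< (1# - δ) δκ′<δ ⟩
            δ + (1# - δ)      ≈⟨ +-comm δ (1# - δ) ⟩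
            1# - δ + δ        ≈⟨ -‿+-cancel 1# δ ⟩
            1#                ∎
        ; 0<κ = λ _ _ → 0<δκ′+1-δ
        ; scale = λ X → begin-equality
            δ * decayIn (estimate X) i (T-M ℕ.+ i ℕ.* J) + (1# - δ) * estimate X t
              ≈⟨ +-cong (*-congˡ (scale′ X)) (*-congˡ (reflexive (≡.cong (λ d → if does d then X else 0#) eq))) ⟩
            δ * (κ′ * X) + (1# - δ) * X
              ≈⟨ solve 4 (λ δ κ ε x → δ :* (κ :* x) :+ ε :* x := (δ :* κ :+ ε) :* x) refl δ κ′ (1# - δ) X ⟩
            (δ * κ′ + (1# - δ)) * X ∎ }
      extend (no Tλ≰t) eq = record
        { κ   = δ * κ′
        ; 0≤κ = 0≤δκ′
        ; κ<1 = <-trans δκ′<δ δ<1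
        ; 0<κ = λ _ Tλ≤t → contradiction Tλ≤t Tλ≰t
        ; scale = λ X → begin-equality
            δ * decayIn (estimate X) i (T-M ℕ.+ i ℕ.* J) + (1# - δ) * estimate X t
              ≈⟨ +-cong (*-congˡ (scale′ X)) (*-congˡ (reflexive (≡.cong (λ d → if does d then X else 0#) eq))) ⟩
            δ * (κ′ * X) + (1# - δ) * 0#
              ≈⟨ +-cong (sym (*-assoc δ κ′ X)) (zeroʳ (1# - δ)) ⟩
            δ * κ′ * X + 0#
              ≈⟨ +-identityʳ _ ⟩
            δ * κ′ * X ∎ }

    -- After `T-M` the dividend is at least 1 + (J - 1) = J, so the quotient is not 0.
    0<bucket : ∀ {t} → Tλ ℕ.≤ t → 0 ℕ.< bucket t
    0<bucket {t} Tλ≤t = ℕ.n≢0⇒n>0 λ bucket≡0 → ℕ.<⇒≱ (m/n≡0⇒m<n {n = J} bucket≡0)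
      (ℕ.≤-trans (ℕ.≤-reflexive (≡.sym (ℕ.suc-pred J)))
        (ℕ.+-monoˡ-≤ (J ∸ 1) (ℕ.m<n⇒0<n∸m (ℕ.<-≤-trans T-M<Tλ Tλ≤t))))

    contribution-scale : ∀ {T} → Tλ ℕ.≤ T →
      ∃ λ κ → 0# < κ × κ < 1# × (∀ X → contribution Tλ X T ≈ κ * X)
    contribution-scale {T} Tλ≤T = κ , 0<κ (0<bucket Tλ≤T) Tλ≤T , κ<1 , scale
      where open Factor (factor (bucket T) T λ bucket≡0 → contradiction bucket≡0 (ℕ.>⇒≢ (0<bucket Tλ≤T)))

-- Comparison of the two intervals

lemma6 : ∀ {c ℓ₁ ℓ₂ v} (K : OrderedField c ℓ₁ ℓ₂) {V : Set v} (_≟_ : DecidableEquality V)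
  {N : ℕ} (S : SimpleStream V N) (M J : ℕ) .{{_ : NonZero J}} →
  let open OrderedField K
      open Expectation K
      open FURL-S K _≟_ M
      open FURL-SX K M J
  in
  (δ √2 : Carrier) → 2 ℕ.≤ M → 0# < δ → δ < 1# → IsSqrt √2 (fromℕ 2) →
  (Δ : Triangle V) (Tλ T : ℕ) → FormedAt S Δ Tλ → M ℕ.+ 1 ℕ.< Tλ →
  √2 * fromℕ M + 1# ≤ᶠ fromℕ Tλ →
  Tλ ℕ.≤ T → (T≤N : T ℕ.≤ N) →
  let P = run S T T≤N
      X : State → Carrier
      X s = count s Δ
      Y : State → Carrier
      Y s = contribution δ Tλ (X s) T
  in
  (𝔼 P X - Var P X < 𝔼 P Y - Var P Y) × (𝔼 P Y + Var P Y < 𝔼 P X + Var P X)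
lemma6 K _≟_ S M J δ √2 2≤M 0<δ δ<1 √2-sqrt Δ zero T formed () _ _ _
lemma6 K _≟_ {N} S M J δ √2 2≤M 0<δ δ<1 √2-sqrt Δ (suc n) T formed (s≤s M+1≤n) √2M+1≤Tλ n<T T≤N =
  (begin-strict
    𝔼 P X - Var P X               ≈⟨ +-cong EX≈1 (-‿cong VX≈v) ⟩
    1# - v                        <⟨ proj₁ interval-⊂ ⟩
    κ - κ * κ * v                 ≈⟨ +-cong EY≈κ (-‿cong VY≈κκv) ⟨
    𝔼 P Y - Var P Y               ∎) ,
  (begin-strict
    𝔼 P Y + Var P Y               ≈⟨ +-cong EY≈κ VY≈κκv ⟩
    κ + κ * κ * v                 <⟨ proj₂ interval-⊂ ⟩
    1# + v                        ≈⟨ +-cong EX≈1 VX≈v ⟨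
    𝔼 P X + Var P X               ∎)
  where
  open OrderedField K hiding (zero)
  open OrderedFieldProperties K
  open Expectation K
  open ExpectationProperties K
  open FURL-S K _≟_ M
  open FURL-SX K M J δ
  open TriangleCount K _≟_ M S Δ
  open <-Reasoning

  n<N : n ℕ.< N
  n<N = ℕ.≤-trans n<T T≤N

  closed = formed⇒closed n<N formed

  P = run S T T≤N

  X Y : State → Carrier
  X s = count s Δ
  Y s = contribution (suc n) (X s) T

  v : Carrier
  v = q (suc n) - 1#

  EX≈1 : 𝔼 P X ≈ 1#
  EX≈1 = 𝔼-count n<N closed 2≤M M+1≤n T T≤N n<T

  VX≈v : Var P X ≈ v
  VX≈v = Var-count n<N closed 2≤M M+1≤n T T≤N n<T

  scaling = DecayFactor.contribution-scale K M J δ 0<δ δ<1 (s≤s M+1≤n) n<T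

  κ : Carrier
  κ = proj₁ scaling

  Y≈κX : ∀ s → Y s ≈ κ * X s
  Y≈κX s = proj₂ (proj₂ (proj₂ scaling)) (X s)

  EY≈κ : 𝔼 P Y ≈ κ
  EY≈κ = begin-equality
    𝔼 P Y               ≈⟨ 𝔼-cong′ P Y≈κX ⟩
    𝔼 P (λ s → κ * X s) ≈⟨ 𝔼-*ˡ P κ X ⟩
    κ * 𝔼 P X           ≈⟨ *-congˡ EX≈1 ⟩
    κ * 1#              ≈⟨ *-identityʳ κ ⟩
    κ                   ∎

  VY≈κκv : Var P Y ≈ κ * κ * v
  VY≈κκv = trans (Var-scale P Y≈κX) (*-congˡ VX≈v)

  √2M≤n : √2 * fromℕ M ≤ᶠ fromℕ n
  √2M≤n = +-cancelʳ-≤ 1# $ begin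
    √2 * fromℕ M + 1# ≤⟨ √2M+1≤Tλ ⟩
    1# + fromℕ n      ≈⟨ +-comm 1# (fromℕ n) ⟩
    fromℕ n + 1#      ∎

  2≤q : fromℕ 2 ≤ᶠ q (suc n)
  2≤q = 2b≤a⇒2≤a/b {a = n ℕ.* (n ∸ 1)} (0<m[m∸1] 2≤M)
    (2m²≤n²⇒2m[m∸1]≤n[n∸1] M n (√2m≤n⇒2m²≤n² M n √2-sqrt √2M≤n))

  1≤v : 1# ≤ᶠ v
  1≤v = +-cancelʳ-≤ 1# $ begin
    1# + 1#           ≈⟨ +-congˡ (+-identityʳ 1#) ⟨
    fromℕ 2           ≤⟨ 2≤q ⟩
    q (suc n)         ≈⟨ -‿+-cancel (q (suc n)) 1# ⟨
    v + 1#            ∎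

  interval-⊂ : (1# - v < κ - κ * κ * v) × (κ + κ * κ * v < 1# + v)
  interval-⊂ = scaled-interval-⊂ (proj₁ (proj₂ scaling)) (proj₁ (proj₂ (proj₂ scaling))) 1≤v
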